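{- Let $P_1$ and $P_2$ be singly labelled CCS processes. Then $[\![P_1]\!] \sim_{hh} [\![P_2]\!]$ (hereditary history preserving bisimilarity) if and only if $[\![P_1]\!] \sim^{\tau} [\![P_2]\!]$ (back-and-forth barbed congruence on configuration structures), i.e. if and only if for every context $C[\cdot]$ one has $[\![C[P_1]]\!] \,\dot\sim^{\tau}\, [\![C[P_2]]\!]$.
   Context: CCS. Let $\mathsf{N}$ be a set of names $a,b,\dots$, $\overline{\mathsf{N}}$ the co-names $\overline{a}$, with $\overline{\overline{a}}=a$; labels are $\mathsf{L}=\mathsf{N}\cup\overline{\mathsf{N}}\cup\{\tau\}$. Finite CCS processes: $P,Q ::= \lambda.P \mid P\,|\,Q \mid \lambda.P+\pi.Q \mid P\backslash a \mid 0$ with $\lambda,\pi\in\mathsf{N}\cup\overline{\mathsf{N}}$. Contexts are $C[\cdot]::=[\cdot]$ or $C[\cdot]::=Q\,|\,[\cdot]$ for a CCS process $Q$; $C[P]$ is the result of filling the hole with $P$. Configuration structures. A (labelled) configuration structure is $\mathcal{C}=(E,C,\ell)$ with $E$ a set of events, $\ell:E\to\mathsf{L}$, and $C\subseteq\mathcal{P}(E)$ (the configurations) satisfying: finiteness (for $x\in C$, $e\in x$ there is a finite $z\in C$ with $e\in z\subseteq x$); coincidence freeness (for $x\in C$ and distinct $e,e'\in x$ there is $z\in C$, $z\subseteq x$, containing exactly one of $e,e'$); finite completeness (if $X\subseteq C$ and some finite $y\in C$ contains every member of $X$, then $\bigcup X\in C$); stability (if $x,y,x\cup y\in C$ then $x\cap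 y\in C$). Write $x\xrightarrow{e}x'$ if $x,x'\in C$, $e\notin x$, $x'=x\cup\{e\}$, and then $x'\xrightarrow{e}_{\mathrm{back}}x$. Causality in $x$: $e_1\le_x e_2$ iff every $z\in C$ with $z\subseteq x$ and $e_2\in z$ contains $e_1$. A label and order preserving bijection $f:x_1\to x_2$ (configurations of $\mathcal{C}_1,\mathcal{C}_2$) is a bijection with $\ell_2(f(e))=\ell_1(e)$ and $e\le_{x_1}e'\iff f(e)\le_{x_2}f(e')$. Operations. $\mathbf{0}=(\emptyset,\{\emptyset\},\emptyset)$. Prefix: $\alpha.(E,C,\ell)=(E\uplus\{e\},\{\emptyset\}\cup\{x\cup\{e\}: x\in C\},\ell')$ with $\ell'(e)=\alpha$, $\ell'=\ell$ on $E$. Coproduct: events $\{1\}\times E_1\cup\{2\}\times E_2$, configurations $\{\{1\}\times x: x\in C_1\}\cup\{\{2\}\times x:x\in C_2\}$, labels inherited. Product $\mathcal{C}_1\times\mathcal{C}_2$: events $E_1\times_\star E_2=\{(e_1,\star)\}\cup\{(\star,e_2)\}\cup\{(e_1,e_2)\}$ ($e_i\in E_i$) with partial projections $\pi_1,\pi_2$ ($\star$ = undefined); a set $x$ of such events is a configuration iff $\pi_1(x)\in C_1$, $\pi_2(x)\in C_2$, $\pi_1,\pi_2$ are injective on $x$ where defined, every $e\in x$ lies in a finite $z\subseteq x$ with $\pi_1(z)\in C_1,\pi_2(z)\in C_2$, and any two distinct $e,e'\in x$ are separated by some $z\subseteq x$ with $\pi_1(z)\in C_1,\pi_2(z)\in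 C_2$. Parallel composition $\mathcal{C}_1|\mathcal{C}_2$: in the product keep the events $(e_1,\star)$ (label $\ell_1(e_1)$), $(\star,e_2)$ (label $\ell_2(e_2)$) and the pairs $(e_1,e_2)$ whose labels are complementary names $\{b,\overline b\}$ (label $\tau$); discard other pairs, and keep the configurations of the product containing only kept events. Restriction of $\mathcal{C}$ by a name $a$: remove events labelled $a$ or $\overline a$ and keep the configurations avoiding them. Encoding: $[\![0]\!]=\mathbf{0}$, $[\![\lambda.P]\!]=\lambda.[\![P]\!]$, $[\![P|Q]\!]=[\![P]\!]|[\![Q]\!]$, $[\![P+Q]\!]=[\![P]\!]+[\![Q]\!]$ (coproduct), $[\![P\backslash a]\!]=$ restriction of $[\![P]\!]$ by $a$. A configuration structure is singly labelled if for every $x\in C$ and $e,e'$ with $x\xrightarrow{e}y$, $x\xrightarrow{e'}y'$ and $\ell(e)=\ell(e')$ we have $e=e'$; a CCS process $P$ is singly labelled if $[\![P]\!]$ is. HHPB. A hereditary history preserving bisimulation between $\mathcal{C}_1,\mathcal{C}_2$ is a relation $\mathcal{R}\subseteq C_1\times C_2\times\mathcal{P}(E_1\times E_2)$, symmetric (its converse satisfies the same clauses with roles exchanged), with $(\emptyset,\emptyset,\emptyset)\in\mathcal{R}$ and such that for $(x_1,x_2,f)\in\mathcal{R}$: $f$ is a label and order preserving bijection $x_1\to x_2$; if $x_1\xrightarrow{e_1}x_1'$ there are $x_2\xrightarrow{e_2}x_2'$ and $f'$ with $f'$ restricting to $f$ on $x_1$ and $(x_1',x_2',f')\in\mathcal{R}$;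 if $x_1\xrightarrow{e_1}_{\mathrm{back}}x_1'$ there are $x_2\xrightarrow{e_2}_{\mathrm{back}}x_2'$ and $f'=f$ restricted to $x_1'$ with $(x_1',x_2',f')\in\mathcal{R}$. $\mathcal{C}_1\sim_{hh}\mathcal{C}_2$ iff such a relation exists. Barbed bisimulation. A back-and-forth barbed bisimulation between $\mathcal{C}_1,\mathcal{C}_2$ is a symmetric relation $\mathcal{R}\subseteq C_1\times C_2$ with $(\emptyset,\emptyset)\in\mathcal{R}$ such that for $(x_1,x_2)\in\mathcal{R}$: if $x_1\xrightarrow{e_1}_{\mathrm{back}}x_1'$ with $\ell_1(e_1)=\tau$ there is $x_2\xrightarrow{e_2}_{\mathrm{back}}x_2'$ with $\ell_2(e_2)=\tau$ and $(x_1',x_2')\in\mathcal{R}$; if $x_1\xrightarrow{e_1}x_1'$ with $\ell_1(e_1)=\tau$ there is $x_2\xrightarrow{e_2}x_2'$ with $\ell_2(e_2)=\tau$ and $(x_1',x_2')\in\mathcal{R}$; if $x_1\xrightarrow{e_1}x_1'$ with $\ell_1(e_1)\neq\tau$ there is $x_2\xrightarrow{e_2}x_2'$ with $\ell_2(e_2)=\ell_1(e_1)$. Write $\mathcal{C}_1\,\dot\sim^{\tau}\,\mathcal{C}_2$ if one exists, and $[\![P_1]\!]\sim^{\tau}[\![P_2]\!]$ iff $[\![C[P_1]]\!]\,\dot\sim^{\tau}\,[\![C[P_2]]\!]$ for every context $C$. -}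

module Defs where

open import Data.Nat using (ℕ; _≡ᵇ_)
open import Data.Bool using (Bool; true; false; _∨_)
open import Data.Empty using (⊥)
open import Level using (Level; Lift; _⊔_; 0ℓ) renaming (suc to lsuc)
open import Data.Unit using (⊤)
open import Data.Maybe using (Maybe; just; nothing)
open import Data.Sum using (_⊎_; inj₁; inj₂)
open import Data.Product using (Σ; _×_; _,_)
open import Data.List using (List)
open import Data.List.Membership.Propositional using (_∈_)
open import Relation.Nullary using (¬_)
open import Relation.Binary.PropositionalEquality using (_≡_)

Iff : {a b : Level} → Set a → Set b → Set (a ⊔ b)
Iff A B = (A → B) × (B → A)

data Act : Set where
  nm : ℕ → Act
  co : ℕ → Act

data Label : Set where
  act : Act → Label
  τ   : Label

data Compl : Label → Label → Set where
  nm-co : ∀ b → Compl (act (nm b)) (act (co b))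
  co-nm : ∀ b → Compl (act (co b)) (act (nm b))

mentions : ℕ → Label → Bool
mentions a (act (nm b)) = a ≡ᵇ b
mentions a (act (co b)) = a ≡ᵇ b
mentions a τ = false

data Proc : Set where
  pre : Act → Proc → Proc
  par : Proc → Proc → Proc
  sum : Act → Proc → Act → Proc → Proc
  res : Proc → ℕ → Proc
  nil : Proc

data Ctx : Set where
  hole  : Ctx
  parCtx : Proc → Ctx

plug : Ctx → Proc → Proc
plug hole P = P
plug (parCtx Q) P = par Q P

Subset : Set → Set₁
Subset E = E → Set

_⊆_ : {E : Set} → Subset E → Subset E → Set
x ⊆ y = ∀ e → x e → y e

Empty : {E : Set} → Subset E → Set
Empty x = ∀ e → ¬ x e

Finite : {E : Set} → Subset E → Set
Finite {E} z = Σ (List E) λ xs → ∀ e → Iff (z e) (e ∈ xs)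

record CS : Set₂ where
  field
    E    : Set
    ℓ    : E → Label
    Conf : Subset E → Set₁
open CS public

-- x --e--> x'  (and then x' --e-->back x)
Step : (C : CS) → Subset (E C) → E C → Subset (E C) → Set₁
Step C x e x' =
  Conf C x × Conf C x' × ¬ x e × (∀ e' → Iff (x' e') (x e' ⊎ e' ≡ e))

Le : (C : CS) → Subset (E C) → E C → E C → Set₁
Le C x e₁ e₂ = ∀ z → Conf C z → z ⊆ x → z e₂ → z e₁

𝟎 : CS
𝟎 = record { E = ⊥ ; ℓ = λ () ; Conf = λ x → Lift (lsuc 0ℓ) (Empty x) }

prefixCS : Label → CS → CS
prefixCS α C = record
  { E = Maybe (E C)
  ; ℓ = lab
  ; Conf = λ y → Lift (lsuc 0ℓ) (Empty y) ⊎ (Lift (lsuc 0ℓ) (y nothing) × Conf C (λ e → y (just e)))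
  }
  where
  lab : Maybe (E C) → Label
  lab nothing = α
  lab (just e) = ℓ C e

coprodCS : CS → CS → CS
coprodCS C₁ C₂ = record
  { E = E C₁ ⊎ E C₂
  ; ℓ = lab
  ; Conf = λ y → (Conf C₁ (λ e → y (inj₁ e)) × Lift (lsuc 0ℓ) (∀ e → ¬ y (inj₂ e)))
               ⊎ (Conf C₂ (λ e → y (inj₂ e)) × Lift (lsuc 0ℓ) (∀ e → ¬ y (inj₁ e)))
  }
  where
  lab : E C₁ ⊎ E C₂ → Label
  lab (inj₁ e) = ℓ C₁ e
  lab (inj₂ e) = ℓ C₂ e

data Ev⋆ (E₁ E₂ : Set) : Set where
  left  : E₁ → Ev⋆ E₁ E₂
  right : E₂ → Ev⋆ E₁ E₂
  both  : E₁ → E₂ → Ev⋆ E₁ E₂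

π₁ : {E₁ E₂ : Set} → Ev⋆ E₁ E₂ → Maybe E₁
π₁ (left e) = just e
π₁ (right _) = nothing
π₁ (both e _) = just e

π₂ : {E₁ E₂ : Set} → Ev⋆ E₁ E₂ → Maybe E₂
π₂ (left _) = nothing
π₂ (right e) = just e
π₂ (both _ e) = just e

image : {A B : Set} → (A → Maybe B) → Subset A → Subset B
image π x b = Σ _ λ a → x a × π a ≡ just b

InjOn : {A B : Set} → (A → Maybe B) → Subset A → Set
InjOn π x = ∀ a a' b → x a → x a' → π a ≡ just b → π a' ≡ just b → a ≡ a'

ProdConf : (C₁ C₂ : CS) → Subset (Ev⋆ (E C₁) (E C₂)) → Set₁
ProdConf C₁ C₂ x =
  Conf C₁ (image π₁ x) × Conf C₂ (image π₂ x)
  × InjOn π₁ x × InjOn π₂ x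
  × (∀ e → x e → Σ (Subset (Ev⋆ (E C₁) (E C₂))) λ z →
        Finite z × z e × z ⊆ x × Proj z)
  × (∀ e e' → x e → x e' → ¬ e ≡ e' → Σ (Subset (Ev⋆ (E C₁) (E C₂))) λ z →
        z ⊆ x × Proj z × ((z e × ¬ z e') ⊎ (¬ z e × z e')))
  where
  Proj : Subset (Ev⋆ (E C₁) (E C₂)) → Set₁
  Proj z = Conf C₁ (image π₁ z) × Conf C₂ (image π₂ z)

Kept : (C₁ C₂ : CS) → Ev⋆ (E C₁) (E C₂) → Set
Kept C₁ C₂ (left _) = ⊤
Kept C₁ C₂ (right _) = ⊤
Kept C₁ C₂ (both e₁ e₂) = Compl (ℓ C₁ e₁) (ℓ C₂ e₂)

parCS : CS → CS → CS
parCS C₁ C₂ = record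
  { E = Σ (Ev⋆ (E C₁) (E C₂)) (Kept C₁ C₂)
  ; ℓ = lab
  ; Conf = λ x → ProdConf C₁ C₂ (λ ev → Σ (Kept C₁ C₂ ev) λ k → x (ev , k))
  }
  where
  lab : Σ (Ev⋆ (E C₁) (E C₂)) (Kept C₁ C₂) → Label
  lab (left e , _) = ℓ C₁ e
  lab (right e , _) = ℓ C₂ e
  lab (both _ _ , _) = τ

resCS : CS → ℕ → CS
resCS C a = record
  { E = Σ (E C) (λ e → mentions a (ℓ C e) ≡ false)
  ; ℓ = λ { (e , _) → ℓ C e }
  ; Conf = λ x → Conf C (λ e → Σ (mentions a (ℓ C e) ≡ false) λ p → x (e , p))
  }

⟦_⟧ : Proc → CS
⟦ pre λ' P ⟧ = prefixCS (act λ') ⟦ P ⟧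
⟦ par P Q ⟧ = parCS ⟦ P ⟧ ⟦ Q ⟧
⟦ sum λ' P π Q ⟧ = coprodCS (prefixCS (act λ') ⟦ P ⟧) (prefixCS (act π) ⟦ Q ⟧)
⟦ res P a ⟧ = resCS ⟦ P ⟧ a
⟦ nil ⟧ = 𝟎

SinglyLabelledCS : CS → Set₁
SinglyLabelledCS C = ∀ x y y' e e' → Step C x e y → Step C x e' y' →
  ℓ C e ≡ ℓ C e' → e ≡ e'

SinglyLabelled : Proc → Set₁
SinglyLabelled P = SinglyLabelledCS ⟦ P ⟧

LOBij : (C₁ C₂ : CS) → Subset (E C₁) → Subset (E C₂) → (E C₁ → E C₂ → Set) → Set₁
LOBij C₁ C₂ x₁ x₂ f =
  (∀ a b → f a b → x₁ a × x₂ b)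
  × (∀ a → x₁ a → Σ (E C₂) λ b → f a b)
  × (∀ b → x₂ b → Σ (E C₁) λ a → f a b)
  × (∀ a b b' → f a b → f a b' → b ≡ b')
  × (∀ a a' b → f a b → f a' b → a ≡ a')
  × (∀ a b → f a b → ℓ C₂ b ≡ ℓ C₁ a)
  × (∀ a a' b b' → f a b → f a' b' → Iff (Le C₁ x₁ a a') (Le C₂ x₂ b b'))

HHRel : CS → CS → Set₂
HHRel C₁ C₂ = Subset (E C₁) → Subset (E C₂) → (E C₁ → E C₂ → Set) → Set₁

HHClauses : (C₁ C₂ : CS) → HHRel C₁ C₂ → Set₁
HHClauses C₁ C₂ R = ∀ x₁ x₂ f → R x₁ x₂ f →
  LOBij C₁ C₂ x₁ x₂ f
  × (∀ e₁ x₁' → Step C₁ x₁ e₁ x₁' →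
       Σ (E C₂) λ e₂ → Σ (Subset (E C₂)) λ x₂' → Σ (E C₁ → E C₂ → Set) λ f' →
         Step C₂ x₂ e₂ x₂' × (∀ a b → x₁ a → Iff (f' a b) (f a b)) × R x₁' x₂' f')
  × (∀ e₁ x₁' → Step C₁ x₁' e₁ x₁ →
       Σ (E C₂) λ e₂ → Σ (Subset (E C₂)) λ x₂' →
         Step C₂ x₂' e₂ x₂ × R x₁' x₂' (λ a b → f a b × x₁' a))

converseHH : {C₁ C₂ : CS} → HHRel C₁ C₂ → HHRel C₂ C₁
converseHH R x₂ x₁ g = R x₁ x₂ (λ a b → g b a)

IsHHPB : (C₁ C₂ : CS) → HHRel C₁ C₂ → Set₁
IsHHPB C₁ C₂ R =
  R (λ _ → ⊥) (λ _ → ⊥) (λ _ _ → ⊥)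
  × HHClauses C₁ C₂ R × HHClauses C₂ C₁ (converseHH {C₁} {C₂} R)

_∼hh_ : CS → CS → Set₂
C₁ ∼hh C₂ = Σ (HHRel C₁ C₂) (IsHHPB C₁ C₂)

BRel : CS → CS → Set₂
BRel C₁ C₂ = Subset (E C₁) → Subset (E C₂) → Set₁

BClauses : (C₁ C₂ : CS) → BRel C₁ C₂ → Set₁
BClauses C₁ C₂ R = ∀ x₁ x₂ → R x₁ x₂ →
  (∀ e₁ x₁' → Step C₁ x₁' e₁ x₁ → ℓ C₁ e₁ ≡ τ →
     Σ (E C₂) λ e₂ → Σ (Subset (E C₂)) λ x₂' →
       Step C₂ x₂' e₂ x₂ × ℓ C₂ e₂ ≡ τ × R x₁' x₂')
  × (∀ e₁ x₁' → Step C₁ x₁ e₁ x₁' → ℓ C₁ e₁ ≡ τ →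
     Σ (E C₂) λ e₂ → Σ (Subset (E C₂)) λ x₂' →
       Step C₂ x₂ e₂ x₂' × ℓ C₂ e₂ ≡ τ × R x₁' x₂')
  × (∀ e₁ x₁' → Step C₁ x₁ e₁ x₁' → ¬ ℓ C₁ e₁ ≡ τ →
     Σ (E C₂) λ e₂ → Σ (Subset (E C₂)) λ x₂' →
       Step C₂ x₂ e₂ x₂' × ℓ C₂ e₂ ≡ ℓ C₁ e₁)

IsBarbed : (C₁ C₂ : CS) → BRel C₁ C₂ → Set₁
IsBarbed C₁ C₂ R =
  R (λ _ → ⊥) (λ _ → ⊥)
  × BClauses C₁ C₂ R × BClauses C₂ C₁ (λ x₂ x₁ → R x₁ x₂)

_∼̇τ_ : CS → CS → Set₂
C₁ ∼̇τ C₂ = Σ (BRel C₁ C₂) (IsBarbed C₁ C₂)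

_∼τ_ : Proc → Proc → Set₂
P₁ ∼τ P₂ = ∀ (K : Ctx) → ⟦ plug K P₁ ⟧ ∼̇τ ⟦ plug K P₂ ⟧

{-# OPTIONS --safe #-}
-- From HHPB to barbed congruence: in Q | P₁ and Q | P₂, relate configurations whose events have
-- equal Q-parts and f-related P-parts.
--
-- From barbed congruence to HHPB: test with Q = Π_i (α_i.0 + o_i.0), with one cell i for every
-- event of P₁ and of P₂, α_i complementary to the label of that event and o_i fresh.  The barbs
-- o_i reveal which cells have been consumed, so visible events of P₁ are paired with events of
-- P₂ consuming the same cell, when going forwards and backwards.  Internal events are paired in
-- their order of execution: in a singly labelled structure an event lies causally above all
-- earlier events with its label (otherwise some configuration would enable two of them), so only
-- the last τ can be undone.  Preservation of causality is then automatic: a subconfiguration is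
-- reached by undoing maximal events, and every undoing step is matched.

module Submission where

open import Defs
open import Axiom.UniquenessOfIdentityProofs.WithK using (uip)
open import Data.Bool using (Bool; true; false; if_then_else_)
import Data.Bool.Properties as Bool
open import Data.Empty using (⊥; ⊥-elim)
open import Data.Fin using (Fin; zero; suc; toℕ)
open import Data.Fin.Properties using (suc-injective; toℕ-injective) renaming (_≟_ to _≟ᶠ_)
open import Data.List using (List; []; _∷_; map; _++_; filter; length; lookup; cartesianProductWith)
open import Data.List.Extrema.Nat using (max; v≤max⁺)
open import Data.List.Membership.Propositional using (_∈_; lose; find)
open import Data.List.Membership.Propositional.Properties using (∈-map⁺; ∈-++⁺ˡ; ∈-++⁺ʳ; ∈-filter⁺; ∈-filter⁻; ∈-cartesianProductWith⁺)
open import Data.List.Membership.Setoid.Properties using (index-injective)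
open import Data.List.Properties using (filter-notAll)
open import Data.List.Relation.Unary.Any using (here; there; any?; index)
open import Data.List.Relation.Unary.Any.Properties using (lookup-index)
open import Data.Maybe using (Maybe; just; nothing)
open import Data.Maybe.Properties using (just-injective) renaming (≡-dec to Maybe-≡-dec)
open import Data.Nat using (ℕ; zero; suc; _≤_; _<_; s≤s; _+_)
import Data.Nat.Properties as ℕ
open import Data.Product using (Σ; _×_; _,_; proj₁; proj₂)
open import Data.Sum using (_⊎_; inj₁; inj₂; [_,_]; [_,_]′) renaming (map to ⊎-map)
open import Data.Sum.Properties using (inj₁-injective; inj₂-injective) renaming (≡-dec to ⊎-≡-dec)
open import Data.Unit using (⊤; tt)
open import Function using (_∘_; id)
open import Level using (Level; lift)
open import Relation.Binary using (DecidableEquality)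
open import Relation.Binary.PropositionalEquality using (_≡_; refl; sym; trans; cong; subst; _≢_; setoid)
open import Relation.Nullary using (¬_; Dec; yes; no; contradiction)
open import Relation.Nullary.Decidable using (_×-dec_; ¬?) renaming (map′ to mapDec)

-- The barbed clauses relate targets only after τ steps, so a visible event is challenged by letting
-- it synchronise with a cell; the obstacle is to guarantee that this cell is still free. Cells are
-- therefore allotted to events rather than to labels, in disjoint families for the two processes:
-- within a process, a cell allotted to one of its own events is consumed by that event only, as a
-- challenger, while cells of the other family are consumed by answers. A cell is a choice so that
-- `o i` can fire exactly while cell `i` is untouched. That firing it destroys the cell is harmless,
-- since the clause for visible steps asks nothing of the targets. The tester may communicate with
-- itself, because the labels of different events may be complementary. Such a step consumes two
-- cells while a challenge consumes at most one, so it is never a valid answer. Single labelling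
-- enters for τ events, which no cell can identify.

infix 4 _≐_
infixl 6 _∪_ _▷_ _-_
infixl 7 _∩_

_≐_ : {E : Set} → Subset E → Subset E → Set
x ≐ y = ∀ e → Iff (x e) (y e)

≐-sym : {E : Set} {x y : Subset E} → x ≐ y → y ≐ x
≐-sym p e = proj₂ (p e) , proj₁ (p e)

≐-trans : {E : Set} {x y z : Subset E} → x ≐ y → y ≐ z → x ≐ z
≐-trans p q e = proj₁ (q e) ∘ proj₁ (p e) , proj₂ (p e) ∘ proj₂ (q e)

∅ : {E : Set} → Subset E
∅ _ = ⊥

_∪_ _∩_ : {E : Set} → Subset E → Subset E → Subset E
(x ∪ y) e = x e ⊎ y e
(x ∩ y) e = x e × y e

_▷_ _-_ : {E : Set} → Subset E → E → Subset E
(x ▷ e) a = x a ⊎ a ≡ e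
(x - e) a = x a × a ≢ e

-- Stable families of configurations

-- Configurations are arbitrary predicates; that those of CCS processes are decidable (dec) is
-- what makes the classical arguments constructive.
record Stable (E : Set) (Conf : Subset E → Set₁) : Set₁ where
  field
    _≟_      : DecidableEquality E
    enum     : List E
    complete : ∀ e → e ∈ enum
    ext      : ∀ {x y} → x ≐ y → Conf x → Conf y
    dec      : ∀ {x} → Conf x → ∀ e → Dec (x e)
    ∅-conf   : Conf ∅
    ∪-conf   : ∀ {w x y} → Conf w → Conf x → Conf y → x ⊆ w → y ⊆ w → Conf (x ∪ y)
    ∩-conf   : ∀ {w x y} → Conf w → Conf x → Conf y → x ⊆ w → y ⊆ w → Conf (x ∩ y)
    sep      : ∀ {x} → Conf x → ∀ e e' → x e → x e' → e ≢ e' →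
               Σ (Subset E) λ z → Conf z × z ⊆ x × ((z e × ¬ z e') ⊎ (¬ z e × z e'))

-- `Stable` speaks of a bare family of subsets because the full product, before pairs are discarded,
-- carries no labels. Compatibility of `x` and `y` is expressed by a common bound `w`; event sets
-- being finite, no finiteness condition on `w` is left to state.
StableCS : CS → Set₁
StableCS C = Stable (E C) (Conf C)

finite : {E : Set} (xs : List E) → (∀ e → e ∈ xs) → {z : Subset E} → (∀ e → Dec (z e)) → Finite z
finite xs all z? = filter z? xs , λ e →
  (λ ze → ∈-filter⁺ z? (all e) ze) , λ m → proj₂ (∈-filter⁻ z? {xs = xs} m)

-- Nil, prefix and coproduct

𝟎-stable : StableCS 𝟎
𝟎-stable = record
  { _≟_ = λ () ; enum = [] ; complete = λ () ; ext = λ _ _ → lift λ () ; dec = λ _ ()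
  ; ∅-conf = lift λ () ; ∪-conf = λ _ _ _ _ _ → lift λ () ; ∩-conf = λ _ _ _ _ _ → lift λ ()
  ; sep = λ _ () }

module _ (α : Label) (C : CS) (S : StableCS C) where
  private
    open module S = Stable S using ()

    Pre : Subset (Maybe (E C)) → Set₁
    Pre = Conf (prefixCS α C)

    under : Set → Subset (E C) → Subset (Maybe (E C))
    under A z nothing  = A
    under A z (just e) = z e

    ext' : ∀ {x y} → x ≐ y → Pre x → Pre y
    ext' p (inj₁ (lift em)) = inj₁ (lift λ e → em e ∘ proj₂ (p e))
    ext' p (inj₂ (lift h , c)) = inj₂ (lift (proj₁ (p nothing) h) , S.ext (p ∘ just) c)

    dec' : ∀ {x} → Pre x → ∀ e → Dec (x e)
    dec' (inj₁ (lift em)) e = no (em e)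
    dec' (inj₂ (lift h , c)) nothing = yes h
    dec' (inj₂ (lift h , c)) (just e) = S.dec c e

    ∪' : ∀ {w x y} → Pre w → Pre x → Pre y → x ⊆ w → y ⊆ w → Pre (x ∪ y)
    ∪' _ (inj₁ (lift a)) (inj₁ (lift b)) _ _ = inj₁ (lift λ e → [ a e , b e ])
    ∪' _ (inj₁ (lift a)) (inj₂ (lift h , c)) _ _ =
      inj₂ (lift (inj₂ h) , S.ext (λ e → inj₂ , [ ⊥-elim ∘ a (just e) , id ]) c)
    ∪' _ (inj₂ (lift h , c)) (inj₁ (lift b)) _ _ =
      inj₂ (lift (inj₁ h) , S.ext (λ e → inj₁ , [ id , ⊥-elim ∘ b (just e) ]) c)
    ∪' (inj₁ (lift em)) (inj₂ (lift h , c)) (inj₂ _) p _ = contradiction (p _ h) (em nothing)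
    ∪' (inj₂ (_ , cw)) (inj₂ (lift h , c)) (inj₂ (_ , d)) p q =
      inj₂ (lift (inj₁ h) , S.∪-conf cw c d (p ∘ just) (q ∘ just))

    ∩' : ∀ {w x y} → Pre w → Pre x → Pre y → x ⊆ w → y ⊆ w → Pre (x ∩ y)
    ∩' _ (inj₁ (lift a)) _ _ _ = inj₁ (lift λ e → a e ∘ proj₁)
    ∩' _ (inj₂ _) (inj₁ (lift b)) _ _ = inj₁ (lift λ e → b e ∘ proj₂)
    ∩' (inj₁ (lift em)) (inj₂ (lift h , c)) (inj₂ _) p _ = contradiction (p _ h) (em nothing)
    ∩' (inj₂ (_ , cw)) (inj₂ (lift h , c)) (inj₂ (lift k , d)) p q =
      inj₂ (lift (h , k) , S.∩-conf cw c d (p ∘ just) (q ∘ just))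

    root : Pre (under ⊤ ∅)
    root = inj₂ (lift tt , S.∅-conf)

    sep' : ∀ {x} → Pre x → ∀ e e' → x e → x e' → e ≢ e' →
           Σ (Subset (Maybe (E C))) λ z → Pre z × z ⊆ x × ((z e × ¬ z e') ⊎ (¬ z e × z e'))
    sep' (inj₁ (lift em)) e _ xe _ _ = contradiction xe (em e)
    sep' (inj₂ _) nothing nothing _ _ ne = contradiction refl ne
    sep' (inj₂ (lift h , _)) nothing (just _) _ _ _ =
      under ⊤ ∅ , root , (λ { nothing _ → h }) , inj₁ (tt , id)
    sep' (inj₂ (lift h , _)) (just _) nothing _ _ _ =
      under ⊤ ∅ , root , (λ { nothing _ → h }) , inj₂ (id , tt)
    sep' (inj₂ (lift h , c)) (just e) (just e') xe xe' ne
      with z , cz , z⊆ , d ← S.sep c e e' xe xe' (ne ∘ cong just) =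
      under ⊤ z , inj₂ (lift tt , cz) , (λ { nothing _ → h ; (just a) → z⊆ a }) , d

  prefix-stable : StableCS (prefixCS α C)
  prefix-stable = record
    { _≟_ = Maybe-≡-dec S._≟_
    ; enum = nothing ∷ map just S.enum
    ; complete = λ { nothing → here refl ; (just e) → there (∈-map⁺ just (S.complete e)) }
    ; ext = ext' ; dec = dec' ; ∅-conf = inj₁ (lift λ _ ())
    ; ∪-conf = ∪' ; ∩-conf = ∩' ; sep = sep' }

module _ (C₁ C₂ : CS) (S₁ : StableCS C₁) (S₂ : StableCS C₂) where
  private
    open module S₁ = Stable S₁ using ()
    open module S₂ = Stable S₂ using ()

    Cop : Subset (E C₁ ⊎ E C₂) → Set₁
    Cop = Conf (coprodCS C₁ C₂)

    -- The empty configuration may carry the tag of either summand. A set tagged with the second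
    -- summand has an empty left part, so `∅-conf` covers this case and the tags of `x` and `w` need
    -- not agree.
    part₁ : ∀ {w x} → (∀ e → ¬ w (inj₂ e)) → x ⊆ w → Cop x → Conf C₁ (x ∘ inj₁)
    part₁ no₂ x⊆w (inj₁ (c , _)) = c
    part₁ no₂ x⊆w (inj₂ (_ , lift no₁)) = S₁.ext (λ e → (λ ()) , no₁ e) S₁.∅-conf

    part₂ : ∀ {w x} → (∀ e → ¬ w (inj₁ e)) → x ⊆ w → Cop x → Conf C₂ (x ∘ inj₂)
    part₂ no₁ x⊆w (inj₁ (_ , lift no₂)) = S₂.ext (λ e → (λ ()) , no₂ e) S₂.∅-conf
    part₂ no₁ x⊆w (inj₂ (c , _)) = c

    ext' : ∀ {x y} → x ≐ y → Cop x → Cop y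
    ext' p (inj₁ (c , lift n)) = inj₁ (S₁.ext (p ∘ inj₁) c , lift λ e → n e ∘ proj₂ (p (inj₂ e)))
    ext' p (inj₂ (c , lift n)) = inj₂ (S₂.ext (p ∘ inj₂) c , lift λ e → n e ∘ proj₂ (p (inj₁ e)))

    dec' : ∀ {x} → Cop x → ∀ e → Dec (x e)
    dec' (inj₁ (c , _)) (inj₁ e) = S₁.dec c e
    dec' (inj₁ (_ , lift n)) (inj₂ e) = no (n e)
    dec' (inj₂ (_ , lift n)) (inj₁ e) = no (n e)
    dec' (inj₂ (c , _)) (inj₂ e) = S₂.dec c e

    ∪' : ∀ {w x y} → Cop w → Cop x → Cop y → x ⊆ w → y ⊆ w → Cop (x ∪ y)
    ∪' (inj₁ (cw , lift n)) cx cy p q = inj₁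
      ( S₁.∪-conf cw (part₁ n p cx) (part₁ n q cy) (p ∘ inj₁) (q ∘ inj₁)
      , lift λ e → n e ∘ [ p (inj₂ e) , q (inj₂ e) ])
    ∪' (inj₂ (cw , lift n)) cx cy p q = inj₂
      ( S₂.∪-conf cw (part₂ n p cx) (part₂ n q cy) (p ∘ inj₂) (q ∘ inj₂)
      , lift λ e → n e ∘ [ p (inj₁ e) , q (inj₁ e) ])

    ∩' : ∀ {w x y} → Cop w → Cop x → Cop y → x ⊆ w → y ⊆ w → Cop (x ∩ y)
    ∩' (inj₁ (cw , lift n)) cx cy p q = inj₁
      ( S₁.∩-conf cw (part₁ n p cx) (part₁ n q cy) (p ∘ inj₁) (q ∘ inj₁)
      , lift λ e → n e ∘ p (inj₂ e) ∘ proj₁)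
    ∩' (inj₂ (cw , lift n)) cx cy p q = inj₂
      ( S₂.∩-conf cw (part₂ n p cx) (part₂ n q cy) (p ∘ inj₂) (q ∘ inj₂)
      , lift λ e → n e ∘ p (inj₁ e) ∘ proj₁)

    sep' : ∀ {x} → Cop x → ∀ e e' → x e → x e' → e ≢ e' →
           Σ (Subset (E C₁ ⊎ E C₂)) λ z → Cop z × z ⊆ x × ((z e × ¬ z e') ⊎ (¬ z e × z e'))
    sep' (inj₁ (_ , lift n)) (inj₂ e) _ xe _ _ = contradiction xe (n e)
    sep' (inj₁ (_ , lift n)) (inj₁ _) (inj₂ e') _ xe' _ = contradiction xe' (n e')
    sep' (inj₁ (c , _)) (inj₁ e) (inj₁ e') xe xe' ne
      with z , cz , z⊆ , d ← S₁.sep c e e' xe xe' (ne ∘ cong inj₁) =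
      [ z , ∅ ] , inj₁ (cz , lift λ _ → id) , (λ { (inj₁ a) → z⊆ a ; (inj₂ _) () }) , d
    sep' (inj₂ (_ , lift n)) (inj₁ e) _ xe _ _ = contradiction xe (n e)
    sep' (inj₂ (_ , lift n)) (inj₂ _) (inj₁ e') _ xe' _ = contradiction xe' (n e')
    sep' (inj₂ (c , _)) (inj₂ e) (inj₂ e') xe xe' ne
      with z , cz , z⊆ , d ← S₂.sep c e e' xe xe' (ne ∘ cong inj₂) =
      [ ∅ , z ] , inj₂ (cz , lift λ _ → id) , (λ { (inj₂ a) → z⊆ a ; (inj₁ _) () }) , d

  coprod-stable : StableCS (coprodCS C₁ C₂)
  coprod-stable = record
    { _≟_ = ⊎-≡-dec S₁._≟_ S₂._≟_
    ; enum = map inj₁ S₁.enum ++ map inj₂ S₂.enum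
    ; complete = λ { (inj₁ e) → ∈-++⁺ˡ (∈-map⁺ inj₁ (S₁.complete e))
                   ; (inj₂ e) → ∈-++⁺ʳ (map inj₁ S₁.enum) (∈-map⁺ inj₂ (S₂.complete e)) }
    ; ext = ext' ; dec = dec'
    ; ∅-conf = inj₁ (S₁.∅-conf , lift λ _ → id)
    ; ∪-conf = ∪' ; ∩-conf = ∩' ; sep = sep' }

-- Images and the product

image-mono : {A B : Set} {π : A → Maybe B} {x y : Subset A} → x ⊆ y → image π x ⊆ image π y
image-mono p b (a , xa , eq) = a , p a xa , eq

image-cong : {A B : Set} {π : A → Maybe B} {x y : Subset A} → x ≐ y → image π x ≐ image π y
image-cong {x = x} {y} p b = image-mono {x = x} {y} (proj₁ ∘ p) b , image-mono {x = y} {x} (proj₂ ∘ p) b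

image-∪ : {A B : Set} {π : A → Maybe B} {x y : Subset A} → image π x ∪ image π y ≐ image π (x ∪ y)
image-∪ b = (λ { (inj₁ (a , xa , eq)) → a , inj₁ xa , eq ; (inj₂ (a , ya , eq)) → a , inj₂ ya , eq })
          , (λ { (a , inj₁ xa , eq) → inj₁ (a , xa , eq) ; (a , inj₂ ya , eq) → inj₂ (a , ya , eq) })

-- Injectivity on the common bound makes the preimages of `b` in `x` and in `y` the same event; in
-- general only one inclusion holds.
image-∩ : {A B : Set} {π : A → Maybe B} {w x y : Subset A} → InjOn π w → x ⊆ w → y ⊆ w →
          image π x ∩ image π y ≐ image π (x ∩ y)
image-∩ {y = y} inj p q b =
    (λ { ((a , xa , eq) , (a' , ya' , eq')) →
         a , (xa , subst y (inj a' a b (q a' ya') (p a xa) eq' eq) ya') , eq })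
  , (λ { (a , (xa , ya) , eq) → (a , xa , eq) , (a , ya , eq) })

image-▷ : {A B : Set} {π : A → Maybe B} {x : Subset A} {a : A} →
          ∀ b → Iff (image π (x ▷ a) b) (image π x b ⊎ π a ≡ just b)
image-▷ b = (λ { (a , inj₁ xa , eq) → inj₁ (a , xa , eq) ; (a , inj₂ refl , eq) → inj₂ eq })
          , (λ { (inj₁ (a , xa , eq)) → a , inj₁ xa , eq ; (inj₂ eq) → _ , inj₂ refl , eq })

InjOn-⊆ : {A B : Set} {π : A → Maybe B} {x y : Subset A} → x ⊆ y → InjOn π y → InjOn π x
InjOn-⊆ p inj a a' b xa xa' = inj a a' b (p a xa) (p a' xa')

module Product (C₁ C₂ : CS) (S₁ : StableCS C₁) (S₂ : StableCS C₂) where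
  private
    open module S₁ = Stable S₁ using ()
    open module S₂ = Stable S₂ using ()

    Ev : Set
    Ev = Ev⋆ (E C₁) (E C₂)

  infix 4 _≟⋆_
  _≟⋆_ : DecidableEquality Ev
  left a ≟⋆ left b = mapDec (cong left) (λ { refl → refl }) (a S₁.≟ b)
  left a ≟⋆ right b = no λ ()
  left a ≟⋆ both b b' = no λ ()
  right a ≟⋆ left b = no λ ()
  right a ≟⋆ right b = mapDec (cong right) (λ { refl → refl }) (a S₂.≟ b)
  right a ≟⋆ both b b' = no λ ()
  both a a' ≟⋆ left b = no λ ()
  both a a' ≟⋆ right b = no λ ()
  both a a' ≟⋆ both b b' = mapDec (λ { (refl , refl) → refl }) (λ { refl → refl , refl }) ((a S₁.≟ b) ×-dec (a' S₂.≟ b'))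

  enum⋆ : List Ev
  enum⋆ = map left S₁.enum ++ map right S₂.enum ++ cartesianProductWith both S₁.enum S₂.enum

  complete⋆ : ∀ e → e ∈ enum⋆
  complete⋆ (left e) = ∈-++⁺ˡ (∈-map⁺ left (S₁.complete e))
  complete⋆ (right e) = ∈-++⁺ʳ (map left S₁.enum) (∈-++⁺ˡ (∈-map⁺ right (S₂.complete e)))
  complete⋆ (both a b) = ∈-++⁺ʳ (map left S₁.enum) (∈-++⁺ʳ (map right S₂.enum)
    (∈-cartesianProductWith⁺ both (S₁.complete a) (S₂.complete b)))

  Proj : Subset Ev → Set₁
  Proj z = Conf C₁ (image π₁ z) × Conf C₂ (image π₂ z)

  -- By injectivity, the event of `x` lying over a given component event is unique; comparing it
  -- with `e` reduces membership in `x` to membership in a component configuration.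
  proj-dec : ∀ {x} → Proj x → InjOn π₁ x → InjOn π₂ x → ∀ e → Dec (x e)
  proj-dec {x} (c₁ , c₂) i₁ i₂ = go
    where
    via : {B : Set} (π : Ev → Maybe B) → InjOn π x → ∀ e b → π e ≡ just b → Dec (image π x b) → Dec (x e)
    via π i e b eq (no n) = no λ xe → n (e , xe , eq)
    via π i e b eq (yes (a , xa , eq')) with a ≟⋆ e
    ... | yes refl = yes xa
    ... | no a≢e = no λ xe → a≢e (i a e b xa xe eq' eq)
    go : ∀ e → Dec (x e)
    go (left a) = via π₁ i₁ _ a refl (S₁.dec c₁ a)
    go (right a) = via π₂ i₂ _ a refl (S₂.dec c₂ a)
    go (both a _) = via π₁ i₁ _ a refl (S₁.dec c₁ a)

  proj-ext : ∀ {x y} → x ≐ y → Proj x → Proj y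
  proj-ext p (c₁ , c₂) = S₁.ext (image-cong p) c₁ , S₂.ext (image-cong p) c₂

  proj-∅ : Proj ∅
  proj-∅ = S₁.ext (λ e → (λ ()) , λ ()) S₁.∅-conf , S₂.ext (λ e → (λ ()) , λ ()) S₂.∅-conf

  ProdC : Subset Ev → Set₁
  ProdC = ProdConf C₁ C₂

  conf-proj : ∀ {x} → ProdC x → Proj x
  conf-proj (c₁ , c₂ , _) = c₁ , c₂

  prod-dec : ∀ {x} → ProdC x → ∀ e → Dec (x e)
  prod-dec (c₁ , c₂ , i₁ , i₂ , _) = proj-dec (c₁ , c₂) i₁ i₂

  proj-∪ : ∀ {w x y} → Proj w → Proj x → Proj y → x ⊆ w → y ⊆ w → Proj (x ∪ y)
  proj-∪ (w₁ , w₂) (x₁ , x₂) (y₁ , y₂) p q =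
    S₁.ext image-∪ (S₁.∪-conf w₁ x₁ y₁ (image-mono p) (image-mono q)) ,
    S₂.ext image-∪ (S₂.∪-conf w₂ x₂ y₂ (image-mono p) (image-mono q))

  proj-∩ : ∀ {w x y} → ProdC w → Proj x → Proj y → x ⊆ w → y ⊆ w → Proj (x ∩ y)
  proj-∩ (w₁ , w₂ , i₁ , i₂ , _) (x₁ , x₂) (y₁ , y₂) p q =
    S₁.ext (image-∩ i₁ p q) (S₁.∩-conf w₁ x₁ y₁ (image-mono p) (image-mono q)) ,
    S₂.ext (image-∩ i₂ p q) (S₂.∩-conf w₂ x₂ y₂ (image-mono p) (image-mono q))

  Separated : Subset Ev → Set₁
  Separated x = ∀ e e' → x e → x e' → ¬ e ≡ e' →
    Σ (Subset Ev) λ z → z ⊆ x × Proj z × ((z e × ¬ z e') ⊎ (¬ z e × z e'))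

  conf-sep : ∀ {x} → ProdC x → Separated x
  conf-sep (_ , _ , _ , _ , _ , s) = s

  -- The finiteness condition is free: `x` is itself a finite set, hence a witness for each of its
  -- events.
  mkConf : ∀ {x} → Proj x → InjOn π₁ x → InjOn π₂ x → Separated x → ProdC x
  mkConf {x} (c₁ , c₂) i₁ i₂ s = c₁ , c₂ , i₁ , i₂ ,
    (λ e xe → x , finite enum⋆ complete⋆ (proj-dec (c₁ , c₂) i₁ i₂) , xe , (λ _ → id) , c₁ , c₂) , s

  -- Separation is inherited from `y`: a separating set is intersected with `x`, and stability of
  -- the components keeps its projections configurations. Undoing a step thus only requires looking
  -- at projections.
  prod-sub : ∀ {x y} → ProdC y → x ⊆ y → Proj x → ProdC x
  prod-sub {x} {y} cy@(_ , _ , i₁ , i₂ , _) p px =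
    mkConf px (InjOn-⊆ p i₁) (InjOn-⊆ p i₂) s
    where
    s : Separated x
    s e e' xe xe' ne with conf-sep cy e e' (p e xe) (p e' xe') ne
    ... | z , z⊆ , pz , d = z ∩ x , (λ _ → proj₂) , proj-∩ cy pz px z⊆ p ,
      ⊎-map (λ { (ze , nze) → (ze , xe) , nze ∘ proj₁ }) (λ { (nze , ze) → nze ∘ proj₁ , (ze , xe') }) d

  prod-ext : ∀ {x y} → x ≐ y → ProdC x → ProdC y
  prod-ext p c = prod-sub c (proj₂ ∘ p) (proj-ext p (conf-proj c))

  fresh-event : ∀ {x : Subset Ev} (e : Ev) → (∀ b → π₁ e ≡ just b → ¬ image π₁ x b) → (∀ b → π₂ e ≡ just b → ¬ image π₂ x b) → ¬ x e
  fresh-event (left a) f₁ f₂ xe = f₁ a refl (_ , xe , refl)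
  fresh-event (right b) f₁ f₂ xe = f₂ b refl (_ , xe , refl)
  fresh-event (both a _) f₁ f₂ xe = f₁ a refl (_ , xe , refl)

  -- Adding a single event needs no separation argument: the old configuration separates the
  -- new event from all others.
  prod-extend : ∀ {x e} → ProdC x → Proj (x ▷ e) →
    (∀ b → π₁ e ≡ just b → ¬ image π₁ x b) → (∀ b → π₂ e ≡ just b → ¬ image π₂ x b) → ProdC (x ▷ e)
  prod-extend {x} {e} c@(_ , _ , i₁ , i₂ , _) pr f₁ f₂ = mkConf pr (inj π₁ i₁ f₁) (inj π₂ i₂ f₂) s
    where
    inj : {B : Set} (π : Ev → Maybe B) → InjOn π x → (∀ b → π e ≡ just b → ¬ image π x b) → InjOn π (x ▷ e)
    inj π i f a a' b (inj₁ xa) (inj₁ xa') = i a a' b xa xa'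
    inj π i f a a' b (inj₁ xa) (inj₂ refl) eq eq' = contradiction (a , xa , eq) (f b eq')
    inj π i f a a' b (inj₂ refl) (inj₁ xa') eq eq' = contradiction (a' , xa' , eq') (f b eq)
    inj π i f a a' b (inj₂ refl) (inj₂ refl) _ _ = refl
    fresh : ¬ x e
    fresh = fresh-event e f₁ f₂
    s : Separated (x ▷ e)
    s a a' (inj₁ xa) (inj₁ xa') ne with conf-sep c a a' xa xa' ne
    ... | z , z⊆ , pz , d = z , (λ u → inj₁ ∘ z⊆ u) , pz , d
    s a a' (inj₁ xa) (inj₂ refl) ne = x , (λ _ → inj₁) , conf-proj c , inj₁ (xa , fresh)
    s a a' (inj₂ refl) (inj₁ xa') ne = x , (λ _ → inj₁) , conf-proj c , inj₂ (fresh , xa')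
    s a a' (inj₂ refl) (inj₂ refl) ne = contradiction refl ne

  interleave : Subset (E C₁) → Subset (E C₂) → Subset Ev
  interleave x y (left a) = x a
  interleave x y (right b) = y b
  interleave x y (both _ _) = ⊥

  interleave-proj : ∀ {x y} → Conf C₁ x → Conf C₂ y → Proj (interleave x y)
  interleave-proj c d =
    S₁.ext (λ e → (λ xe → left e , xe , refl) , λ { (left _ , xe , refl) → xe ; (right _ , _ , ()) }) c ,
    S₂.ext (λ e → (λ ye → right e , ye , refl) , λ { (right _ , ye , refl) → ye ; (left _ , _ , ()) }) d

  interleave-conf : ∀ {x y} → Conf C₁ x → Conf C₂ y → ProdC (interleave x y)
  interleave-conf {x} {y} c d = mkConf (interleave-proj c d)
    (λ { (left _) (left _) _ _ _ refl refl → refl ; (right _) _ _ _ _ () ; (left _) (right _) _ _ _ _ () })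
    (λ { (right _) (right _) _ _ _ refl refl → refl ; (left _) _ _ _ _ () ; (right _) (left _) _ _ _ _ () }) s
    where
    x-only : Subset Ev
    x-only = interleave x ∅
    x⊆ : x-only ⊆ interleave x y
    x⊆ (left _) = id
    x⊆ (right _) ()
    x⊆ (both _ _) ()
    s : Separated (interleave x y)
    s (left a) (left a') xa xa' ne with S₁.sep c a a' xa xa' (ne ∘ cong left)
    ... | z , cz , z⊆ , dz = interleave z ∅ ,
      (λ { (left u) → z⊆ u ; (right _) () ; (both _ _) () }) , interleave-proj cz S₂.∅-conf , dz
    s (left a) (right b) xa _ _ = x-only , x⊆ , interleave-proj c S₂.∅-conf , inj₁ (xa , id)
    s (right b) (left a) _ xa _ = x-only , x⊆ , interleave-proj c S₂.∅-conf , inj₂ (id , xa)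
    s (right b) (right b') yb yb' ne with S₂.sep d b b' yb yb' (ne ∘ cong right)
    ... | z , cz , z⊆ , dz = interleave ∅ z ,
      (λ { (right u) → z⊆ u ; (left _) () ; (both _ _) () }) , interleave-proj S₁.∅-conf cz , dz

  private
    ∪' : ∀ {w x y} → ProdC w → ProdC x → ProdC y → x ⊆ w → y ⊆ w → ProdC (x ∪ y)
    ∪' {w} {x} {y} cw@(_ , _ , i₁ , i₂ , _) cx cy p q =
      mkConf (proj-∪ (conf-proj cw) (conf-proj cx) (conf-proj cy) p q) (InjOn-⊆ pq i₁) (InjOn-⊆ pq i₂) s
      where
      pq : (x ∪ y) ⊆ w
      pq e = [ p e , q e ]
      s : Separated (x ∪ y)
      -- If just one of the events is in `x`, then `x` separates them; otherwise both lie in `x` or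
      -- both in `y`.
      s e e' m m' ne with prod-dec cx e | prod-dec cx e'
      ... | yes xe | no xe' = x , (λ _ → inj₁) , conf-proj cx , inj₁ (xe , xe')
      ... | no xe | yes xe' = x , (λ _ → inj₁) , conf-proj cx , inj₂ (xe , xe')
      ... | yes xe | yes xe' with conf-sep cx e e' xe xe' ne
      ...   | z , z⊆ , pz , d = z , (λ u → inj₁ ∘ z⊆ u) , pz , d
      s e e' (inj₁ xe) _ ne | no nxe | no nxe' = contradiction xe nxe
      s e e' (inj₂ _) (inj₁ xe') ne | no nxe | no nxe' = contradiction xe' nxe'
      s e e' (inj₂ ye) (inj₂ ye') ne | no nxe | no nxe' with conf-sep cy e e' ye ye' ne
      ...   | z , z⊆ , pz , d = z , (λ u → inj₂ ∘ z⊆ u) , pz , d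

    ∩' : ∀ {w x y} → ProdC w → ProdC x → ProdC y → x ⊆ w → y ⊆ w → ProdC (x ∩ y)
    ∩' cw cx cy p q = prod-sub cx (λ _ → proj₁) (proj-∩ cw (conf-proj cx) (conf-proj cy) p q)

  prod-stable : Stable Ev ProdC
  prod-stable = record
    { _≟_ = _≟⋆_ ; enum = enum⋆ ; complete = complete⋆
    ; ext = prod-ext ; dec = prod-dec
    ; ∅-conf = mkConf proj-∅ (λ _ _ _ ()) (λ _ _ _ ()) (λ _ _ ())
    ; ∪-conf = ∪' ; ∩-conf = ∩'
    ; sep = λ c e e' xe xe' ne → let z , z⊆ , pz , d = conf-sep c e e' xe xe' ne in
        z , prod-sub c z⊆ pz , z⊆ , d }

-- Discarding events, and stability for all processes

-- Both parallel composition (from the product) and restriction discard the events outside a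
-- decidable proposition K; under-K forgets the proofs of K.
under-K : {A : Set} {K : A → Set} → Subset (Σ A K) → Subset A
under-K {K = K} x a = Σ (K a) λ k → x (a , k)

module _ {A : Set} {D : Subset A → Set₁} (S : Stable A D) (K : A → Set)
         (K? : ∀ a → Dec (K a)) (K-prop : ∀ {a} (k k' : K a) → k ≡ k') where
  private
    open module S = Stable S using ()

    enumΣ : List A → List (Σ A K)
    enumΣ [] = []
    enumΣ (a ∷ as) with K? a
    ... | yes k = (a , k) ∷ enumΣ as
    ... | no _ = enumΣ as

    completeΣ : ∀ {a as} → a ∈ as → (k : K a) → (a , k) ∈ enumΣ as
    completeΣ {a} (here refl) k with K? a
    ... | yes k' = here (cong (a ,_) (K-prop k k'))
    ... | no n = contradiction k n
    completeΣ {as = b ∷ _} (there m) k with K? b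
    ... | yes _ = there (completeΣ m k)
    ... | no _ = completeΣ m k

    eqΣ : DecidableEquality (Σ A K)
    eqΣ (a , k) (a' , k') with a S.≟ a'
    ... | yes refl = yes (cong (a ,_) (K-prop k k'))
    ... | no ne = no (ne ∘ cong proj₁)

    D' : Subset (Σ A K) → Set₁
    D' x = D (under-K x)

    mono : ∀ {x y : Subset (Σ A K)} → x ⊆ y → under-K x ⊆ under-K y
    mono p a (k , xa) = k , p _ xa

    dec' : ∀ {x} → D' x → ∀ e → Dec (x e)
    dec' {x} c (a , k) with S.dec c a
    ... | yes (k' , xa) = yes (subst (λ k → x (a , k)) (K-prop k' k) xa)
    ... | no n = no λ xa → n (k , xa)

    ∪≐ : ∀ {x y : Subset (Σ A K)} → under-K x ∪ under-K y ≐ under-K (x ∪ y)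
    ∪≐ a = (λ { (inj₁ (k , xa)) → k , inj₁ xa ; (inj₂ (k , ya)) → k , inj₂ ya })
         , (λ { (k , inj₁ xa) → inj₁ (k , xa) ; (k , inj₂ ya) → inj₂ (k , ya) })

    ∩≐ : ∀ {x y : Subset (Σ A K)} → under-K x ∩ under-K y ≐ under-K (x ∩ y)
    ∩≐ {y = y} a = (λ { ((k , xa) , (k' , ya)) → k , xa , subst (λ k → y (a , k)) (K-prop k' k) ya })
                 , (λ { (k , xa , ya) → (k , xa) , (k , ya) })

    sep' : ∀ {x} → D' x → ∀ e e' → x e → x e' → e ≢ e' →
           Σ (Subset (Σ A K)) λ z → D' z × z ⊆ x × ((z e × ¬ z e') ⊎ (¬ z e × z e'))
    sep' {x} c (a , k) (a' , k') xa xa' ne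
      with z , cz , z⊆ , d ← S.sep c a a' (k , xa) (k' , xa') (λ { refl → ne (cong (a ,_) (K-prop k k')) }) =
      z ∘ proj₁ , S.ext (λ b → (λ zb → proj₁ (z⊆ b zb) , zb) , proj₂) cz ,
      (λ { (b , l) zb → let l' , xb = z⊆ b zb in subst (λ l → x (b , l)) (K-prop l' l) xb }) , d

  sub-stable : Stable (Σ A K) (λ x → D (under-K x))
  sub-stable = record
    { _≟_ = eqΣ ; enum = enumΣ S.enum ; complete = λ { (a , k) → completeΣ (S.complete a) k }
    ; ext = λ p → S.ext (λ a → mono (proj₁ ∘ p) a , mono (proj₂ ∘ p) a)
    ; dec = dec'
    ; ∅-conf = S.ext (λ a → (λ ()) , λ ()) S.∅-conf
    ; ∪-conf = λ cw cx cy p q → S.ext ∪≐ (S.∪-conf cw cx cy (mono p) (mono q))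
    ; ∩-conf = λ cw cx cy p q → S.ext ∩≐ (S.∩-conf cw cx cy (mono p) (mono q))
    ; sep = sep' }

Compl-prop : ∀ {l m} (k k' : Compl l m) → k ≡ k'
Compl-prop (nm-co b) (nm-co .b) = refl
Compl-prop (co-nm b) (co-nm .b) = refl

Compl? : ∀ l m → Dec (Compl l m)
Compl? (act (nm a)) (act (co b)) = mapDec (λ { refl → nm-co a }) (λ { (nm-co _) → refl }) (a ℕ.≟ b)
Compl? (act (co a)) (act (nm b)) = mapDec (λ { refl → co-nm a }) (λ { (co-nm _) → refl }) (a ℕ.≟ b)
Compl? (act (nm _)) (act (nm _)) = no λ ()
Compl? (act (co _)) (act (co _)) = no λ ()
Compl? (act _) τ = no λ ()
Compl? τ _ = no λ ()

Kept-prop : ∀ {C₁ C₂ e} (k k' : Kept C₁ C₂ e) → k ≡ k'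
Kept-prop {e = left _} _ _ = refl
Kept-prop {e = right _} _ _ = refl
Kept-prop {e = both _ _} = Compl-prop

Kept? : ∀ C₁ C₂ e → Dec (Kept C₁ C₂ e)
Kept? C₁ C₂ (left _) = yes tt
Kept? C₁ C₂ (right _) = yes tt
Kept? C₁ C₂ (both a b) = Compl? (ℓ C₁ a) (ℓ C₂ b)

par-stable : ∀ C₁ C₂ → StableCS C₁ → StableCS C₂ → StableCS (parCS C₁ C₂)
par-stable C₁ C₂ S₁ S₂ = sub-stable (Product.prod-stable C₁ C₂ S₁ S₂) (Kept C₁ C₂) (Kept? C₁ C₂)
  (λ {e} → Kept-prop {C₁} {C₂} {e})

proc-stable : ∀ P → StableCS ⟦ P ⟧
proc-stable (pre α P) = prefix-stable (act α) ⟦ P ⟧ (proc-stable P)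
proc-stable (par P Q) = par-stable ⟦ P ⟧ ⟦ Q ⟧ (proc-stable P) (proc-stable Q)
proc-stable (sum α P β Q) = coprod-stable (prefixCS (act α) ⟦ P ⟧) (prefixCS (act β) ⟦ Q ⟧)
  (prefix-stable (act α) ⟦ P ⟧ (proc-stable P)) (prefix-stable (act β) ⟦ Q ⟧ (proc-stable Q))
proc-stable (res P a) = sub-stable (proc-stable P) (λ e → mentions a (ℓ ⟦ P ⟧ e) ≡ false)
  (λ e → mentions a (ℓ ⟦ P ⟧ e) Bool.≟ false) uip
proc-stable nil = 𝟎-stable

-- Removing maximal events

module Removal (C : CS) (S : StableCS C) where
  open Stable S

  private
    without : E C → List (E C) → List (E C)
    without c = filter (λ a → ¬? (a ≟ c))

    without-< : ∀ {c L} → c ∈ L → length (without c L) < length L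
    without-< {c} {L} m = filter-notAll (λ a → ¬? (a ≟ c)) L (lose m (λ ne → ne refl))

    keep : ∀ {c a L} → a ∈ L → a ≢ c → a ∈ without c L
    keep {c} m ne = ∈-filter⁺ (λ a → ¬? (a ≟ c)) m ne

    -- If two events of x lie outside z, some u separates them, and z ∪ u is a larger
    -- proper subconfiguration of x.
    removable : ∀ n L → length L ≤ n → ∀ {x z} → Conf C x → Conf C z → z ⊆ x →
      (∀ a → x a → ¬ z a → a ∈ L) → ∀ e → x e → ¬ z e →
      Σ (E C) λ e' → x e' × ¬ z e' × Conf C (x - e')
    removable n L len {x} {z} cx cz z⊆x cov e xe nze
      with any? (λ a → dec cx a ×-dec ¬? (dec cz a) ×-dec ¬? (a ≟ e)) L
    ... | no none = e , xe , nze , ext z≐ cz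
      where
      z≐ : z ≐ x - e
      proj₁ (z≐ a) za = z⊆x a za , λ { refl → nze za }
      proj₂ (z≐ a) (xa , a≢e) with dec cz a
      ... | yes za = za
      ... | no nza = contradiction (lose (cov a xa nza) (xa , nza , a≢e)) none
    ... | yes some with find some
    ... | e' , _ , xe' , nze' , e'≢e = split n len (sep cx e' e xe' xe e'≢e)
      where
      split : ∀ n → length L ≤ n →
        (Σ (Subset (E C)) λ u → Conf C u × u ⊆ x × ((u e' × ¬ u e) ⊎ (¬ u e' × u e))) →
        Σ (E C) λ a → x a × ¬ z a × Conf C (x - a)
      step : ∀ n → length L ≤ n → ∀ u → Conf C u → u ⊆ x → ∀ c c' → x c → ¬ z c → u c → x c' → ¬ z c' → ¬ u c' →
        Σ (E C) λ a → x a × ¬ z a × Conf C (x - a)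
      step zero len u cu u⊆x c c' xc nzc uc xc' nzc' nuc' =
        contradiction (ℕ.<-≤-trans (without-< (cov c xc nzc)) len) λ ()
      step (suc n) len u cu u⊆x c c' xc nzc uc xc' nzc' nuc' =
        -- `L` covers the part of `x` outside `z`, and `n` bounds its length. Passing to `z ∪ u`
        -- strikes `c` from `L`, while `c'` witnesses that the enlarged set is still proper.
        let a , xa , nza , ca = removable n (without c L) (ℕ.≤-pred (ℕ.<-≤-trans (without-< (cov c xc nzc)) len))
              cx (∪-conf cx cz cu z⊆x u⊆x) (λ a → [ z⊆x a , u⊆x a ])
              (λ a xa n → keep (cov a xa (n ∘ inj₁)) λ { refl → n (inj₂ uc) })
              c' xc' [ nzc' , nuc' ]
        in a , xa , nza ∘ inj₁ , ca
      split n len (u , cu , u⊆x , inj₁ (ue' , nue)) = step n len u cu u⊆x e' e xe' nze' ue' xe nze nue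
      split n len (u , cu , u⊆x , inj₂ (nue' , ue)) = step n len u cu u⊆x e e' xe nze ue xe' nze' nue'

  -- Induction along a removal path: `z` is reached from `x` through configurations, one event at a
  -- time. The end point is only `≐` to `z`, since `Pr` need not respect pointwise equality.
  descend : {p : Level} (Pr : Subset (E C) → Set p) → ∀ {z} → Conf C z →
    (∀ x e → Conf C x → Conf C (x - e) → x e → ¬ z e → z ⊆ x → Pr x → Pr (x - e)) →
    ∀ {x} → Conf C x → z ⊆ x → Pr x → Σ (Subset (E C)) λ y → y ≐ z × Pr y
  descend Pr {z} cz next cx z⊆x px = go (length enum) enum ℕ.≤-refl cx z⊆x (λ a _ _ → complete a) px
    where
    go : ∀ n L → length L ≤ n → ∀ {x} → Conf C x → z ⊆ x → (∀ a → x a → ¬ z a → a ∈ L) →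
         Pr x → Σ (Subset (E C)) λ y → y ≐ z × Pr y
    go n L len {x} cx z⊆x cov px with any? (λ a → dec cx a ×-dec ¬? (dec cz a)) L
    ... | no none = x , (λ a → in-z a , z⊆x a) , px
      where
      in-z : x ⊆ z
      in-z a xa with dec cz a
      ... | yes za = za
      ... | no nza = contradiction (lose (cov a xa nza) (xa , nza)) none
    ... | yes some with find some
    ... | e , _ , xe , nze with removable (length L) L ℕ.≤-refl cx cz z⊆x cov e xe nze
    go zero L len cx z⊆x cov px | yes _ | _ | e , xe , nze , _ =
      contradiction (ℕ.<-≤-trans (without-< (cov e xe nze)) len) λ ()
    go (suc n) L len {x} cx z⊆x cov px | yes _ | _ | e , xe , nze , c =
      go n (without e L) (ℕ.≤-pred (ℕ.<-≤-trans (without-< (cov e xe nze)) len)) c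
         (λ a za → z⊆x a za , λ { refl → nze za })
         (λ { a (xa , a≢e) nza → keep (cov a xa nza) a≢e })
         (next x e cx c xe nze z⊆x px)

  remove-step : ∀ {x e} → Conf C (x - e) → Conf C x → x e → Step C (x - e) e x
  remove-step {x} {e} c c' xe = c , c' , (λ { (_ , ne) → ne refl }) , λ a → to a , λ { (inj₁ (xa , _)) → xa ; (inj₂ refl) → xe }
    where
    to : ∀ a → x a → (x - e) a ⊎ a ≡ e
    to a xa with a ≟ e
    ... | yes a≡e = inj₂ a≡e
    ... | no a≢e = inj₁ (xa , a≢e)

  -- Otherwise some configuration would enable both t and e.
  same-label-below : SinglyLabelledCS C → ∀ {x e x' t} → Step C x e x' → x t → ℓ C t ≡ ℓ C e → Le C x' t e
  same-label-below single {x} {e} {x'} {t} (cx , cx' , nxe , x'≐) xt eq z cz z⊆x' ze =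
    -- The descent goes from `x` to `z ∩ x` and carries `t` along; if `t` survives to the end, it
    -- lies in `z`.
    let y , y≐ , _ , yt = descend Pr (∩-conf cx' cz cx z⊆x' x⊆x') next cx (λ _ → proj₂) ((λ _ → id) , xt)
    in proj₁ (proj₁ (y≐ t) yt)
    where
    x⊆x' : x ⊆ x'
    x⊆x' a = proj₂ (x'≐ a) ∘ inj₁
    Pr : Subset (E C) → Set
    Pr y = y ⊆ x × y t
    next : ∀ y a → Conf C y → Conf C (y - a) → y a → ¬ (z ∩ x) a → (z ∩ x) ⊆ y → Pr y → Pr (y - a)
    next y a cy cy- ya na zx⊆y (y⊆x , yt) with a ≟ t
    ... | no a≢t = (λ b → y⊆x b ∘ proj₁) , yt , a≢t ∘ sym
    -- If `t` is the event to be removed, then `y - t` enables `t` and, since its union with `z`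
    -- adds exactly `e`, also `e`. Single labelling identifies the two, although only `t` lies in
    -- `x`.
    ... | yes refl = contradiction
      (single (y - t) y ((y - t) ▷ e) t e (remove-step cy- cy yt)
        (cy- , ext adj (∪-conf cx' cy- cz (λ b → x⊆x' b ∘ y⊆x b ∘ proj₁) z⊆x') , (nxe ∘ y⊆x e ∘ proj₁) , λ _ → id , id) eq)
      (λ { refl → nxe xt })
      where
      adj : (y - t) ∪ z ≐ (y - t) ▷ e
      proj₁ (adj b) (inj₁ m) = inj₁ m
      proj₁ (adj b) (inj₂ zb) with proj₁ (x'≐ b) (z⊆x' b zb)
      ... | inj₂ b≡e = inj₂ b≡e
      ... | inj₁ xb = inj₁ (zx⊆y b (zb , xb) , λ { refl → na (zb , xb) })
      proj₂ (adj b) (inj₁ m) = inj₁ m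
      proj₂ (adj b) (inj₂ refl) = inj₂ ze

-- Hereditary relations preserve order

LabBij : (C₁ C₂ : CS) → Subset (E C₁) → Subset (E C₂) → (E C₁ → E C₂ → Set) → Set
LabBij C₁ C₂ x₁ x₂ f =
  (∀ a b → f a b → x₁ a × x₂ b)
  × (∀ a → x₁ a → Σ (E C₂) λ b → f a b)
  × (∀ b → x₂ b → Σ (E C₁) λ a → f a b)
  × (∀ a b b' → f a b → f a b' → b ≡ b')
  × (∀ a a' b → f a b → f a' b → a ≡ a')
  × (∀ a b → f a b → ℓ C₂ b ≡ ℓ C₁ a)

LabBij-sym : ∀ {C₁ C₂ x₁ x₂ f} → LabBij C₁ C₂ x₁ x₂ f → LabBij C₂ C₁ x₂ x₁ (λ b a → f a b)
LabBij-sym (d , t₁ , t₂ , fn , inj , lab) =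
  (λ b a p → let u , v = d a b p in v , u) , t₂ , t₁ , (λ b a a' → inj a a' b) , (λ b b' a → fn a b b') , λ b a p → sym (lab a b p)

Forth Back : (C₁ C₂ : CS) → HHRel C₁ C₂ → Set₁
Forth C₁ C₂ R = ∀ x₁ x₂ f → R x₁ x₂ f → ∀ e₁ x₁' → Step C₁ x₁ e₁ x₁' →
  Σ (E C₂) λ e₂ → Σ (Subset (E C₂)) λ x₂' → Σ (E C₁ → E C₂ → Set) λ f' →
    Step C₂ x₂ e₂ x₂' × (∀ a b → x₁ a → Iff (f' a b) (f a b)) × R x₁' x₂' f'
Back C₁ C₂ R = ∀ x₁ x₂ f → R x₁ x₂ f → ∀ e₁ x₁' → Step C₁ x₁' e₁ x₁ →
  Σ (E C₂) λ e₂ → Σ (Subset (E C₂)) λ x₂' →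
    Step C₂ x₂' e₂ x₂ × R x₁' x₂' (λ a b → f a b × x₁' a)

module _ (C₁ C₂ : CS) (S₁ : StableCS C₁) (R : HHRel C₁ C₂)
         (confs : ∀ x₁ x₂ f → R x₁ x₂ f → Conf C₁ x₁ × Conf C₂ x₂)
         (bij : ∀ x₁ x₂ f → R x₁ x₂ f → LabBij C₁ C₂ x₁ x₂ f)
         (back : Back C₁ C₂ R) where
  open Removal C₁ S₁

  -- A subconfiguration of x₁ is reached by undoing events; the matching undone x₂ is a
  -- configuration to which the order hypothesis applies.
  order-reflected : ∀ {x₁ x₂ f} → R x₁ x₂ f → ∀ {a a' b b'} → f a b → f a' b' →
    Le C₂ x₂ b b' → Le C₁ x₁ a a'
  order-reflected {x₁} {x₂} {f} r {a} {a'} {b} {b'} fab fab' le z cz z⊆ za' =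
    let y , y≐ , y₂ , g , ry , y₂⊆ , g≐ = descend Pr cz next (proj₁ (confs _ _ _ r)) z⊆
              (x₂ , f , r , (λ _ → id) , λ c d → (λ p → p , proj₁ (proj₁ (bij _ _ _ r) c d p)) , proj₁)
        d , _ , t₂ , _ = bij _ _ _ ry
        _ , _ , _ , _ , inj , _ = bij _ _ _ r
        -- As `a'` survives the descent, so does its partner `b'`; the hypothesis then keeps `b` in
        -- `y₂`, and by injectivity of `f` the partner of `b` is `a`.
        c , gcb = t₂ b (le y₂ (proj₂ (confs _ _ _ ry)) y₂⊆ (proj₂ (d _ _ (proj₂ (g≐ a' b') (fab' , proj₂ (y≐ a') za')))))
        fcb , yc = proj₁ (g≐ c b) gcb
    in proj₁ (y≐ a) (subst y (inj _ _ _ fcb fab) yc)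
    where
    Pr : Subset (E C₁) → Set₁
    Pr y = Σ (Subset (E C₂)) λ y₂ → Σ (E C₁ → E C₂ → Set) λ g →
      R y y₂ g × y₂ ⊆ x₂ × (∀ c d → Iff (g c d) (f c d × y c))
    next : ∀ y e → Conf C₁ y → Conf C₁ (y - e) → y e → ¬ z e → z ⊆ y → Pr y → Pr (y - e)
    next y e cy cy- ye _ _ (y₂ , g , ry , y₂⊆ , g≐)
      with e₂ , y₂' , (_ , _ , _ , y₂≐) , ry' ← back _ _ _ ry e (y - e) (remove-step cy- cy ye) =
      y₂' , _ , ry' , (λ b → y₂⊆ b ∘ proj₂ (y₂≐ b) ∘ inj₁) ,
      λ c d → (λ { (gcd , m) → proj₁ (proj₁ (g≐ c d) gcd) , m }) ,
              (λ { (fcd , m) → proj₂ (g≐ c d) (fcd , proj₁ m) , m })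

hereditary⇒HHPB : (C₁ C₂ : CS) → StableCS C₁ → StableCS C₂ → (R : HHRel C₁ C₂) →
  R ∅ ∅ (λ _ _ → ⊥) →
  (∀ x₁ x₂ f → R x₁ x₂ f → Conf C₁ x₁ × Conf C₂ x₂) →
  (∀ x₁ x₂ f → R x₁ x₂ f → LabBij C₁ C₂ x₁ x₂ f) →
  Forth C₁ C₂ R → Forth C₂ C₁ (converseHH {C₁} {C₂} R) →
  Back C₁ C₂ R → Back C₂ C₁ (converseHH {C₁} {C₂} R) → IsHHPB C₁ C₂ R
hereditary⇒HHPB C₁ C₂ S₁ S₂ R r∅ confs bij forth₁ forth₂ back₁ back₂ =
  r∅ , (λ x₁ x₂ f r → lobij r , forth₁ x₁ x₂ f r , back₁ x₁ x₂ f r)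
     , (λ x₂ x₁ g r → lobij-sym r , forth₂ x₂ x₁ g r , back₂ x₂ x₁ g r)
  where
  R⁻¹ : HHRel C₂ C₁
  R⁻¹ = converseHH {C₁} {C₂} R
  confs⁻¹ : ∀ x₂ x₁ g → R⁻¹ x₂ x₁ g → Conf C₂ x₂ × Conf C₁ x₁
  confs⁻¹ x₂ x₁ g r = let c₁ , c₂ = confs _ _ _ r in c₂ , c₁
  bij⁻¹ : ∀ x₂ x₁ g → R⁻¹ x₂ x₁ g → LabBij C₂ C₁ x₂ x₁ g
  bij⁻¹ x₂ x₁ g r = LabBij-sym {C₁} {C₂} (bij _ _ _ r)
  order : ∀ {x₁ x₂ f} → R x₁ x₂ f → ∀ a a' b b' → f a b → f a' b' → Iff (Le C₁ x₁ a a') (Le C₂ x₂ b b')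
  order r a a' b b' p q = order-reflected C₂ C₁ S₂ R⁻¹ confs⁻¹ bij⁻¹ back₂ r p q
                        , order-reflected C₁ C₂ S₁ R confs bij back₁ r p q
  lobij : ∀ {x₁ x₂ f} → R x₁ x₂ f → LOBij C₁ C₂ x₁ x₂ f
  lobij r = let d , t₁ , t₂ , fn , inj , lab = bij _ _ _ r in d , t₁ , t₂ , fn , inj , lab , order r
  lobij-sym : ∀ {x₂ x₁ g} → R⁻¹ x₂ x₁ g → LOBij C₂ C₁ x₂ x₁ g
  lobij-sym r = let d , t₁ , t₂ , fn , inj , lab = bij⁻¹ _ _ _ r in d , t₁ , t₂ , fn , inj , lab ,
                    λ b b' a a' p q → let u , v = order r a a' b b' p q in v , u

-- Steps of a parallel composition

step-cong : ∀ C → StableCS C → ∀ {x x' y y' e} → x ≐ x' → y ≐ y' → Step C x e y → Step C x' e y'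
step-cong C S p q (c , d , n , s) = Stable.ext S p c , Stable.ext S q d , n ∘ proj₂ (p _) ,
  λ a → ⊎-map (proj₁ (p a)) id ∘ proj₁ (s a) ∘ proj₂ (q a) , proj₁ (q a) ∘ proj₂ (s a) ∘ ⊎-map (proj₂ (p a)) id

under-K-at : {A : Set} {K : A → Set} → (∀ {a} (k k' : K a) → k ≡ k') →
  {x : Subset (Σ A K)} → ∀ {a} → under-K x a → ∀ k → x (a , k)
under-K-at prop {x} {a} (k' , xa) k = subst (λ k → x (a , k)) (prop k' k) xa

module Parallel (C₁ C₂ : CS) (S₁ : StableCS C₁) (S₂ : StableCS C₂) where
  open Product C₁ C₂ S₁ S₂

  Par : CS
  Par = parCS C₁ C₂

  p₁ : Subset (E Par) → Subset (E C₁)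
  p₁ X = image π₁ (under-K X)

  p₂ : Subset (E Par) → Subset (E C₂)
  p₂ X = image π₂ (under-K X)

  member-at : ∀ (X : Subset (E Par)) {u} → under-K X u → ∀ k → X (u , k)
  member-at X = under-K-at (λ {u} → Kept-prop {C₁} {C₂} {u}) {X}

  under-▷ : ∀ (X : Subset (E Par)) {u k} → under-K (X ▷ (u , k)) ≐ under-K X ▷ u
  under-▷ X {k = k} v = (λ { (l , inj₁ m) → inj₁ (l , m) ; (l , inj₂ refl) → inj₂ refl })
                    , (λ { (inj₁ (l , m)) → l , inj₁ m ; (inj₂ refl) → k , inj₂ refl })

  under-remove : ∀ (X : Subset (E Par)) {u k} → under-K (X - (u , k)) ≐ under-K X - u
  under-remove X {u} {k} v =
      (λ { (l , m , ne) → (l , m) , λ { refl → ne (cong (u ,_) (Kept-prop {C₁} {C₂} {u} l k)) } })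
    , (λ { ((l , m) , ne) → l , m , ne ∘ cong proj₁ })

  add-step : ∀ {X u} (k : Kept C₁ C₂ u) → Conf Par X →
    (∀ a → π₁ u ≡ just a → ¬ p₁ X a) → (∀ b → π₂ u ≡ just b → ¬ p₂ X b) →
    Conf C₁ (image π₁ (under-K X ▷ u)) → Conf C₂ (image π₂ (under-K X ▷ u)) →
    Step Par X (u , k) (X ▷ (u , k))
  add-step {X} {u} k c f₁ f₂ c₁ c₂ = c ,
    prod-ext (≐-sym (under-▷ X)) (prod-extend c (c₁ , c₂) f₁ f₂) ,
    (λ m → fresh-event {under-K X} u f₁ f₂ (k , m)) , λ _ → id , id

  del-step : ∀ {X u k} → Conf Par X → X (u , k) →
    Conf C₁ (image π₁ (under-K X - u)) → Conf C₂ (image π₂ (under-K X - u)) →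
    Step Par (X - (u , k)) (u , k) X
  del-step {X} c m c₁ c₂ = Removal.remove-step Par (par-stable C₁ C₂ S₁ S₂)
    (prod-ext (≐-sym (under-remove X)) (prod-sub c (λ _ → proj₁) (c₁ , c₂))) c m

  module _ {X X' : Subset (E Par)} {u : Ev⋆ (E C₁) (E C₂)} {k : Kept C₁ C₂ u} (st : Step Par X (u , k) X') where
    private
      x'≐ : X' ≐ X ▷ (u , k)
      x'≐ = proj₂ (proj₂ (proj₂ st))

    step-add : under-K X' ≐ under-K X ▷ u
    proj₁ (step-add v) (l , m) = proj₁ (under-▷ X v) (l , proj₁ (x'≐ (v , l)) m)
    proj₂ (step-add v) m = let l , n = proj₂ (under-▷ X {k = k} v) m in l , proj₂ (x'≐ (v , l)) n

    step-new : under-K X' u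
    step-new = proj₂ (step-add u) (inj₂ refl)

    step-old : under-K X ⊆ under-K X'
    step-old v m = proj₂ (step-add v) (inj₁ m)

    step-fresh : ¬ under-K X u
    step-fresh m = proj₁ (proj₂ (proj₂ st)) (member-at X m k)

    -- An old event with the same first component would coincide with `u`, by injectivity of the
    -- projection on `X'`.
    step-fresh₁ : ∀ a → π₁ u ≡ just a → ¬ p₁ X a
    step-fresh₁ a eq (v , m , eq') =
      let _ , (_ , _ , i₁ , _) , _ = st
      in step-fresh (subst (under-K X) (i₁ v u a (step-old v m) step-new eq' eq) m)

    step-fresh₂ : ∀ b → π₂ u ≡ just b → ¬ p₂ X b
    step-fresh₂ b eq (v , m , eq') =
      let _ , (_ , _ , _ , i₂ , _) , _ = st
      in step-fresh (subst (under-K X) (i₂ v u b (step-old v m) step-new eq' eq) m)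

    step-p₁ : ∀ a → Iff (p₁ X' a) (p₁ X a ⊎ π₁ u ≡ just a)
    step-p₁ a = proj₁ (image-▷ a) ∘ proj₁ (image-cong step-add a) , proj₂ (image-cong step-add a) ∘ proj₂ (image-▷ a)

    step-p₂ : ∀ b → Iff (p₂ X' b) (p₂ X b ⊎ π₂ u ≡ just b)
    step-p₂ b = proj₁ (image-▷ b) ∘ proj₁ (image-cong step-add b) , proj₂ (image-cong step-add b) ∘ proj₂ (image-▷ b)

    step-right : ∀ {b} → π₂ u ≡ just b → Step C₂ (p₂ X) b (p₂ X')
    step-right {b} eq = proj₁ (proj₂ (proj₁ st)) , proj₁ (proj₂ (proj₁ (proj₂ st))) , step-fresh₂ b eq ,
      λ c → (λ m → [ inj₁ , (λ eq' → inj₂ (just-injective (trans (sym eq') eq))) ]′ (proj₁ (step-p₂ c) m))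
          , (λ m → proj₂ (step-p₂ c) ([ inj₁ , (λ { refl → inj₂ eq }) ]′ m))

    step-idle₂ : π₂ u ≡ nothing → p₂ X ≐ p₂ X'
    step-idle₂ eq b = proj₂ (step-p₂ b) ∘ inj₁
                    , [ id , (λ eq' → contradiction (trans (sym eq) eq') λ ()) ]′ ∘ proj₁ (step-p₂ b)

-- Hereditary history preserving bisimilarity is a barbed congruence

module _ {C₁ C₂ : CS} {R : HHRel C₁ C₂} (cl : HHClauses C₁ C₂ R) where

  -- The forth clause does not say that `f'` relates the two new events. It must: were the image of
  -- `e₁` an old event, that event would already have a preimage in `x₁`, against injectivity of
  -- `f'`.
  forth-pair : ∀ {x₁ x₂ f e₁ x₁' e₂ x₂' f'} → R x₁ x₂ f → R x₁' x₂' f' → Step C₁ x₁ e₁ x₁' → Step C₂ x₂ e₂ x₂' →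
    (∀ a b → x₁ a → Iff (f' a b) (f a b)) → f' e₁ e₂
  forth-pair {x₁} {x₂} {f} {e₁} {e₂ = e₂} {f' = f'} r r' (_ , _ , n₁ , s₁) (_ , _ , _ , s₂) ex
    with cl _ _ _ r | cl _ _ _ r'
  ... | (d , _ , t₂ , _) , _ | (d' , t₁' , _ , _ , inj' , _) , _
    with b , p ← t₁' e₁ (proj₂ (s₁ e₁) (inj₂ refl))
    with proj₁ (s₂ b) (proj₂ (d' _ _ p))
  ... | inj₂ refl = p
  ... | inj₁ x₂b with a , q ← t₂ b x₂b
    with refl ← inj' _ _ _ (proj₂ (ex a b (proj₁ (d _ _ q))) q) p = contradiction (proj₁ (d _ _ q)) n₁

  -- The preimage of `e₂` cannot remain in `x₁'`, for then the restricted bijection would still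
  -- reach `e₂`, which has left `x₂'`.
  back-pair : ∀ {x₁ x₂ f e₁ x₁' e₂ x₂'} → R x₁ x₂ f → R x₁' x₂' (λ a b → f a b × x₁' a) →
    Step C₁ x₁' e₁ x₁ → Step C₂ x₂' e₂ x₂ → f e₁ e₂
  back-pair {e₁ = e₁} {e₂ = e₂} r r' (_ , _ , _ , s₁) (_ , _ , n₂ , s₂)
    with cl _ _ _ r | cl _ _ _ r'
  ... | (d , _ , t₂ , _) , _ | (d' , _) , _
    with a , p ← t₂ e₂ (proj₂ (s₂ e₂) (inj₂ refl))
    with proj₁ (s₁ a) (proj₁ (d _ _ p))
  ... | inj₂ refl = p
  ... | inj₁ x₁'a = contradiction (proj₂ (d' _ _ (p , x₁'a))) n₂

  hh⇒barbed-clauses : BClauses C₁ C₂ (λ x₁ x₂ → Σ (E C₁ → E C₂ → Set) λ f → R x₁ x₂ f)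
  hh⇒barbed-clauses x₁ x₂ (f , r) with cl x₁ x₂ f r
  ... | (_ , _ , _ , _ , _ , lab , _) , forth , back =
      (λ e₁ x₁' st eq → let e₂ , x₂' , st₂ , r' = back e₁ x₁' st in
         e₂ , x₂' , st₂ , trans (lab _ _ (back-pair r r' st st₂)) eq , _ , r')
    , (λ e₁ x₁' st eq → let e₂ , x₂' , f' , st₂ , ex , r' = forth e₁ x₁' st in
         e₂ , x₂' , st₂ , trans (new-label r' st st₂ ex) eq , f' , r')
    , (λ e₁ x₁' st _ → let e₂ , x₂' , f' , st₂ , ex , r' = forth e₁ x₁' st in
         e₂ , x₂' , st₂ , new-label r' st st₂ ex)
    where
    new-label : ∀ {e₁ x₁' e₂ x₂' f'} → R x₁' x₂' f' → Step C₁ x₁ e₁ x₁' → Step C₂ x₂ e₂ x₂' →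
      (∀ a b → x₁ a → Iff (f' a b) (f a b)) → ℓ C₂ e₂ ≡ ℓ C₁ e₁
    new-label r' st st₂ ex with cl _ _ _ r'
    ... | (_ , _ , _ , _ , _ , lab' , _) , _ = lab' _ _ (forth-pair r r' st st₂ ex)

data Match {Q E₁ E₂ : Set} (f : E₁ → E₂ → Set) : Ev⋆ Q E₁ → Ev⋆ Q E₂ → Set where
  left  : ∀ {q} → Match f (left q) (left q)
  right : ∀ {a b} → f a b → Match f (right a) (right b)
  both  : ∀ {q a b} → f a b → Match f (both q a) (both q b)

match-π₁ : ∀ {Q E₁ E₂ : Set} {f : E₁ → E₂ → Set} {u : Ev⋆ Q E₁} {v} → Match f u v → π₁ u ≡ π₁ v
match-π₁ left = refl
match-π₁ (right _) = refl
match-π₁ (both _) = refl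

match-sym : ∀ {Q E₁ E₂ : Set} {f : E₁ → E₂ → Set} {u : Ev⋆ Q E₁} {v} → Match f u v → Match (λ b a → f a b) v u
match-sym left = left
match-sym (right p) = right p
match-sym (both p) = both p

match-map : ∀ {Q E₁ E₂ : Set} {f g : E₁ → E₂ → Set} {u : Ev⋆ Q E₁} {v} →
  (∀ a b → π₂ u ≡ just a → f a b → g a b) → Match f u v → Match g u v
match-map h left = left
match-map h (right p) = right (h _ _ refl p)
match-map h (both p) = both (h _ _ refl p)

match-fun : ∀ {Q E₁ E₂ : Set} {f : E₁ → E₂ → Set} → (∀ a b b' → f a b → f a b' → b ≡ b') →
  ∀ {u : Ev⋆ Q E₁} {v v'} → Match f u v → Match f u v' → v ≡ v'
match-fun fn left left = refl
match-fun fn (right p) (right p') = cong right (fn _ _ _ p p')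
match-fun fn (both p) (both p') = cong (both _) (fn _ _ _ p p')

match-π₂ : ∀ {Q E₁ E₂ : Set} {f : E₁ → E₂ → Set} {u : Ev⋆ Q E₁} {v} → Match f u v →
  (π₂ u ≡ nothing × π₂ v ≡ nothing) ⊎ (Σ E₁ λ a → Σ E₂ λ b → π₂ u ≡ just a × π₂ v ≡ just b × f a b)
match-π₂ left = inj₁ (refl , refl)
match-π₂ (right p) = inj₂ (_ , _ , refl , refl , p)
match-π₂ (both p) = inj₂ (_ , _ , refl , refl , p)

partner : ∀ {Q E₁ E₂ : Set} {f : E₁ → E₂ → Set} {u : Ev⋆ Q E₁} {a b} → π₂ u ≡ just a → f a b →
  Σ (Ev⋆ Q E₂) λ v → Match f u v × π₂ v ≡ just b
partner {u = right _} refl p = right _ , right p , refl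
partner {u = both q _} refl p = both q _ , both p , refl

π₂-view : {E₁ E₂ : Set} (u : Ev⋆ E₁ E₂) → (Σ E₁ λ a → u ≡ left a) ⊎ (Σ E₂ λ b → π₂ u ≡ just b)
π₂-view (left a) = inj₁ (a , refl)
π₂-view (right b) = inj₂ (b , refl)
π₂-view (both _ b) = inj₂ (b , refl)

Matched : ∀ {Q E₁ E₂ : Set} → (E₁ → E₂ → Set) → Subset (Ev⋆ Q E₁) → Subset (Ev⋆ Q E₂) → Set
Matched f U V = (∀ u → U u → Σ _ λ v → V v × Match f u v) × (∀ v → V v → Σ _ λ u → U u × Match f u v)

matched-π₁ : ∀ {Q E₁ E₂ : Set} {f : E₁ → E₂ → Set} {U : Subset (Ev⋆ Q E₁)} {V} → Matched f U V → image π₁ U ≐ image π₁ V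
matched-π₁ (to , from) q =
    (λ { (u , m , eq) → let v , n , c = to u m in v , n , trans (sym (match-π₁ c)) eq })
  , (λ { (v , n , eq) → let u , m , c = from v n in u , m , trans (match-π₁ c) eq })

matched-sym : ∀ {Q E₁ E₂ : Set} {f : E₁ → E₂ → Set} {U : Subset (Ev⋆ Q E₁)} {V} → Matched f U V → Matched (λ b a → f a b) V U
matched-sym (to , from) = (λ v n → let u , m , c = from v n in u , m , match-sym c)
                        , (λ u m → let v , n , c = to u m in v , n , match-sym c)

module HHCongruence (Q C₁ C₂ : CS) (SQ : StableCS Q) (S₁ : StableCS C₁) (S₂ : StableCS C₂) where
  private
    open module SQ = Stable SQ using ()
    open module S₁ = Stable S₁ using ()
    open module S₂ = Stable S₂ using ()
    open module P₁ = Parallel Q C₁ SQ S₁ using ()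
    open module P₂ = Parallel Q C₂ SQ S₂ using ()

  -- `R` need not respect pointwise equality of subsets, so the configurations it relates are
  -- carried along and only compared with the projections by `≐`.
  Lifted : HHRel C₁ C₂ → BRel (parCS Q C₁) (parCS Q C₂)
  Lifted R X₁ X₂ = Σ (Subset (E C₁)) λ x₁ → Σ (Subset (E C₂)) λ x₂ → Σ (E C₁ → E C₂ → Set) λ f →
    R x₁ x₂ f × Conf (parCS Q C₁) X₁ × Conf (parCS Q C₂) X₂ × x₁ ≐ P₁.p₂ X₁ × x₂ ≐ P₂.p₂ X₂
    × Matched f (under-K X₁) (under-K X₂)

  module _ {R : HHRel C₁ C₂} (cl : HHClauses C₁ C₂ R) where

    match-kept : ∀ {x₁ x₂ f} → R x₁ x₂ f → ∀ {u v} → Match f u v → Kept Q C₁ u → Kept Q C₂ v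
    match-kept r left k = tt
    match-kept r (right _) k = tt
    match-kept r (both {q} p) k with cl _ _ _ r
    ... | (_ , _ , _ , _ , _ , lab , _) , _ = subst (Compl (ℓ Q q)) (sym (lab _ _ p)) k

    match-label : ∀ {x₁ x₂ f} → R x₁ x₂ f → ∀ {u v} → Match f u v → ∀ k k' →
      ℓ (parCS Q C₂) (v , k') ≡ ℓ (parCS Q C₁) (u , k)
    match-label r left k k' = refl
    match-label r (both p) k k' = refl
    match-label r (right p) k k' with cl _ _ _ r
    ... | (_ , _ , _ , _ , _ , lab , _) , _ = lab _ _ p

    module _ {X₁ X₂ x₁ x₂ f} (r : R x₁ x₂ f) (c₁ : Conf (parCS Q C₁) X₁) (c₂ : Conf (parCS Q C₂) X₂)
             (x₁≐ : x₁ ≐ P₁.p₂ X₁) (x₂≐ : x₂ ≐ P₂.p₂ X₂)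
             (mt : Matched f (under-K X₁) (under-K X₂)) where

      -- Matched events have the same `Q`-part, so the `Q`-projection of the answer is that of the
      -- challenge and is known to be a configuration; only the process component has to be
      -- supplied.
      extend-matched : ∀ {u k X₁' v x₁' x₂' f'} → Step (parCS Q C₁) X₁ (u , k) X₁' →
        R x₁' x₂' f' → Match f' u v → (∀ a b → x₁ a → f a b → f' a b) → x₁' ≐ P₁.p₂ X₁' →
        Conf C₂ x₂' → x₂' ≐ image π₂ (under-K X₂ ▷ v) → (∀ b → π₂ v ≡ just b → ¬ P₂.p₂ X₂ b) →
        ∀ k' → Σ _ λ X₂' → Step (parCS Q C₂) X₂ (v , k') X₂' × Lifted R X₁' X₂'
      extend-matched {u} {k} {X₁'} {v} {f' = f'} st r' uv ff' x₁'≐ cx₂' x₂'≐ fr k' =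
        X₂ ▷ (v , k') , st₂ ,
        _ , _ , f' , r' , proj₁ (proj₂ st) , proj₁ (proj₂ st₂) , x₁'≐ , ≐-trans x₂'≐ (image-cong (≐-sym (P₂.under-▷ X₂))) ,
        ( (λ w m → let w' , m' , c = proj₁ mt' w m in w' , proj₂ (P₂.under-▷ X₂ w') m' , c)
        , (λ w m → proj₂ mt' w (proj₁ (P₂.under-▷ X₂ w) m)))
        where
        mt' : Matched f' (under-K X₁') (under-K X₂ ▷ v)
        proj₁ mt' w m with proj₁ (P₁.step-add st w) m
        ... | inj₂ refl = v , inj₂ refl , uv
        ... | inj₁ m' with w' , n , c ← proj₁ mt w m' =
          w' , inj₁ n , match-map (λ a b eq → ff' a b (proj₂ (x₁≐ a) (w , m' , eq))) c
        proj₂ mt' w' (inj₂ refl) = u , P₁.step-new st , uv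
        proj₂ mt' w' (inj₁ n) with w , m , c ← proj₂ mt w' n =
          w , P₁.step-old st w m , match-map (λ a b eq → ff' a b (proj₂ (x₁≐ a) (w , m , eq))) c
        st₂ : Step (parCS Q C₂) X₂ (v , k') (X₂ ▷ (v , k'))
        st₂ = P₂.add-step k' c₂
          (λ q eq m → P₁.step-fresh₁ st q (trans (match-π₁ uv) eq) (proj₂ (matched-π₁ mt q) m)) fr
          (SQ.ext (matched-π₁ mt') (proj₁ (proj₁ (proj₂ st)))) (S₂.ext x₂'≐ cx₂')

      -- `f` is a bijection, so `u` and `v` match nothing but each other, and deleting both leaves
      -- the remaining events matched.
      restrict-matched : ∀ {u k X₁' v x₁' x₂' f'} → Step (parCS Q C₁) X₁' (u , k) X₁ →
        Match f u v → under-K X₂ v → R x₁' x₂' f' → (∀ a b → Iff (f' a b) (f a b × x₁' a)) →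
        x₁' ≐ P₁.p₂ X₁' → Conf C₂ x₂' → x₂' ≐ image π₂ (under-K X₂ - v) →
        ∀ k' → Σ _ λ X₂' → Step (parCS Q C₂) X₂' (v , k') X₂ × Lifted R X₁' X₂'
      restrict-matched {u} {k} {X₁'} {v} {x₁'} {f' = f'} st uv nv r' ff' x₁'≐ cx₂' x₂'≐ k' with cl _ _ _ r
      ... | (_ , _ , _ , fn , inj , _) , _ =
        X₂ - (v , k') , st₂ ,
        _ , _ , f' , r' , proj₁ st , proj₁ st₂ , x₁'≐ , ≐-trans x₂'≐ (image-cong (≐-sym (P₂.under-remove X₂))) ,
        ( (λ w m → let w' , m' , c = proj₁ mt' w m in w' , proj₂ (P₂.under-remove X₂ w') m' , c)
        , (λ w m → proj₂ mt' w (proj₁ (P₂.under-remove X₂ w) m)))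
        where
        down : ∀ {w w'} → under-K X₁' w → Match f w w' → Match f' w w'
        down {w} m = match-map λ a b eq p → proj₂ (ff' a b) (p , proj₂ (x₁'≐ a) (w , m , eq))
        mt' : Matched f' (under-K X₁') (under-K X₂ - v)
        proj₁ mt' w m with w' , n , c ← proj₁ mt w (P₁.step-old st w m) =
          w' , (n , λ { refl → P₁.step-fresh st (subst (under-K X₁')
            (match-fun (λ b a a' → inj a a' b) (match-sym c) (match-sym uv)) m) }) , down m c
        proj₂ mt' w' (n , ne) with w , m , c ← proj₂ mt w' n with proj₁ (P₁.step-add st w) m
        ... | inj₁ m' = w , m' , down m' c
        ... | inj₂ refl = contradiction (match-fun fn c uv) ne
        st₂ : Step (parCS Q C₂) (X₂ - (v , k')) (v , k') X₂
        st₂ = P₂.del-step c₂ (P₂.member-at X₂ nv k')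
          (SQ.ext (matched-π₁ mt') (proj₁ (proj₁ st))) (S₂.ext x₂'≐ cx₂')

      private
        cx₂ : Conf C₂ x₂
        cx₂ = S₂.ext (≐-sym x₂≐) (proj₁ (proj₂ c₂))

      forth-lifted : ∀ {u k X₁'} → Step (parCS Q C₁) X₁ (u , k) X₁' →
        Σ (E (parCS Q C₂)) λ e₂ → Σ _ λ X₂' → Step (parCS Q C₂) X₂ e₂ X₂'
          × ℓ (parCS Q C₂) e₂ ≡ ℓ (parCS Q C₁) (u , k) × Lifted R X₁' X₂'
      forth-lifted {u} {k} {X₁'} st with π₂-view u
      -- `Q` moves alone: the related triple stays as it is.
      ... | inj₁ (q , refl) =
        let X₂' , st₂ , l = extend-matched st r left (λ _ _ _ → id) (≐-trans x₁≐ (P₁.step-idle₂ st refl))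
              cx₂ (≐-trans x₂≐ λ b → proj₂ (image-▷ b) ∘ inj₁ , [ id , (λ ()) ]′ ∘ proj₁ (image-▷ b)) (λ _ ()) tt
        in _ , X₂' , st₂ , refl , l
      ... | inj₂ (a , eq)
        with _ , forth , _ ← cl _ _ _ r
        with b , x₂' , f' , st₂@(_ , cx₂' , nb , s₂) , ex , r' ← forth a _ (step-cong C₁ S₁ (≐-sym x₁≐) (λ _ → id , id) (P₁.step-right st eq))
        with v , uv , eq' ← partner {u = u} eq (forth-pair cl r r' (step-cong C₁ S₁ (≐-sym x₁≐) (λ _ → id , id) (P₁.step-right st eq)) st₂ ex) =
        let k' = match-kept r' uv k
            X₂' , st₂ , l = extend-matched st r' uv (λ c d m → proj₂ (ex c d m)) (λ _ → id , id) cx₂'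
              (λ c → (λ m → proj₂ (image-▷ c) (⊎-map (proj₁ (x₂≐ c)) (λ { refl → eq' }) (proj₁ (s₂ c) m)))
                   , (λ m → proj₂ (s₂ c) (⊎-map (proj₂ (x₂≐ c)) (λ e → just-injective (trans (sym e) eq')) (proj₁ (image-▷ c) m))))
              (λ c e m → nb (subst x₂ (just-injective (trans (sym e) eq')) (proj₂ (x₂≐ c) m))) k'
        in _ , X₂' , st₂ , match-label r' uv k k' , l

      back-lifted : ∀ {u k X₁'} → Step (parCS Q C₁) X₁' (u , k) X₁ →
        Σ (E (parCS Q C₂)) λ e₂ → Σ _ λ X₂' → Step (parCS Q C₂) X₂' e₂ X₂
          × ℓ (parCS Q C₂) e₂ ≡ ℓ (parCS Q C₁) (u , k) × Lifted R X₁' X₂'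
      back-lifted {u} {k} {X₁'} st
        with v , nv , uv ← proj₁ mt u (P₁.step-new st)
        with match-kept r uv k | match-π₂ uv | cl _ _ _ r
      ... | k' | inj₁ (eq , eq') | (dom , _) , _ =
        let X₂' , st₂ , l = restrict-matched st uv nv r (λ a b → (λ p → p , proj₁ (dom a b p)) , proj₁)
              (≐-trans x₁≐ (≐-sym (P₁.step-idle₂ st eq))) cx₂
              (≐-trans x₂≐ λ b → (λ { (w , m , e) → w , (m , λ { refl → contradiction (trans (sym eq') e) λ () }) , e })
                              , (λ { (w , (m , _) , e) → w , m , e })) k'
        in _ , X₂' , st₂ , match-label r uv k k' , l
      ... | k' | inj₂ (a , b , eq , eq' , fab) | (_ , _ , _ , fn , _) , _ , back
        with b' , x₂' , st₂@(cx₂' , _ , nb , s₂) , r' ← back a _ (step-cong C₁ S₁ (λ _ → id , id) (≐-sym x₁≐) (P₁.step-right st eq))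
        with refl ← fn _ _ _ fab (back-pair cl r r' (step-cong C₁ S₁ (λ _ → id , id) (≐-sym x₁≐) (P₁.step-right st eq)) st₂) =
        let X₂' , st₂ , l = restrict-matched st uv nv r' (λ _ _ → id , id) (λ _ → id , id) cx₂' x₂'≐ k'
        in _ , X₂' , st₂ , match-label r uv k k' , l
        where
        x₂'≐ : x₂' ≐ image π₂ (under-K X₂ - v)
        proj₁ (x₂'≐ c) m with w , n , e ← proj₁ (x₂≐ c) (proj₂ (s₂ c) (inj₁ m)) =
          w , (n , λ { refl → nb (subst x₂' (just-injective (trans (sym e) eq')) m) }) , e
        proj₂ (x₂'≐ c) (w , (n , ne) , e) with proj₁ (s₂ c) (proj₂ (x₂≐ c) (w , n , e))
        ... | inj₁ m = m
        ... | inj₂ refl = contradiction (proj₁ (proj₂ (proj₂ (proj₂ c₂))) w v c n nv e eq') ne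

    lifted-clauses : BClauses (parCS Q C₁) (parCS Q C₂) (Lifted R)
    lifted-clauses X₁ X₂ (x₁ , x₂ , f , r , c₁ , c₂ , x₁≐ , x₂≐ , mt) =
        (λ e₁ X₁' st eq → let e₂ , X₂' , st₂ , l , rel = back-lifted r c₁ c₂ x₁≐ x₂≐ mt st in e₂ , X₂' , st₂ , trans l eq , rel)
      , (λ e₁ X₁' st eq → let e₂ , X₂' , st₂ , l , rel = forth-lifted r c₁ c₂ x₁≐ x₂≐ mt st in e₂ , X₂' , st₂ , trans l eq , rel)
      , (λ e₁ X₁' st _ → let e₂ , X₂' , st₂ , l , rel = forth-lifted r c₁ c₂ x₁≐ x₂≐ mt st in e₂ , X₂' , st₂ , l)

-- The converse of a lifted relation is the lifting of the converse up to reordering of tuples; this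
-- transports the clauses across.
BClauses-resp : ∀ {C₁ C₂} {R R' : BRel C₁ C₂} → (∀ x y → R x y → R' x y) → (∀ x y → R' x y → R x y) →
  BClauses C₁ C₂ R → BClauses C₁ C₂ R'
BClauses-resp to from cl x₁ x₂ r with cl x₁ x₂ (from _ _ r)
... | b , f , o = (λ e x st eq → let e₂ , x₂' , st₂ , l , r' = b e x st eq in e₂ , x₂' , st₂ , l , to _ _ r')
                , (λ e x st eq → let e₂ , x₂' , st₂ , l , r' = f e x st eq in e₂ , x₂' , st₂ , l , to _ _ r') , o

hh⇒barbed-congruence : ∀ P₁ P₂ → ⟦ P₁ ⟧ ∼hh ⟦ P₂ ⟧ → P₁ ∼τ P₂
hh⇒barbed-congruence P₁ P₂ (R , r∅ , cl , cl⁻¹) hole =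
  (λ x₁ x₂ → Σ _ λ f → R x₁ x₂ f) , (_ , r∅) , hh⇒barbed-clauses cl ,
  BClauses-resp (λ { _ _ (g , r) → (λ a b → g b a) , r }) (λ { _ _ (f , r) → (λ b a → f a b) , r }) (hh⇒barbed-clauses cl⁻¹)
hh⇒barbed-congruence P₁ P₂ (R , r∅ , cl , cl⁻¹) (parCtx Q) =
  D.Lifted R ,
  (_ , _ , _ , r∅ , par∅ P₁ , par∅ P₂ , (λ _ → (λ ()) , λ ()) , (λ _ → (λ ()) , λ ()) , (λ _ ()) , λ _ ()) ,
  D.lifted-clauses cl ,
  BClauses-resp
    (λ { _ _ (x₂ , x₁ , g , r , c₂ , c₁ , p₂ , p₁ , m) → x₁ , x₂ , (λ a b → g b a) , r , c₁ , c₂ , p₁ , p₂ , matched-sym m })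
    (λ { _ _ (x₁ , x₂ , f , r , c₁ , c₂ , p₁ , p₂ , m) → x₂ , x₁ , (λ b a → f a b) , r , c₂ , c₁ , p₂ , p₁ , matched-sym m })
    (D⁻¹.lifted-clauses cl⁻¹)
  where
  module D = HHCongruence ⟦ Q ⟧ ⟦ P₁ ⟧ ⟦ P₂ ⟧ (proc-stable Q) (proc-stable P₁) (proc-stable P₂)
  module D⁻¹ = HHCongruence ⟦ Q ⟧ ⟦ P₂ ⟧ ⟦ P₁ ⟧ (proc-stable Q) (proc-stable P₂) (proc-stable P₁)
  par∅ : ∀ P → Conf ⟦ par Q P ⟧ ∅
  par∅ P = Stable.∅-conf (proc-stable (par Q P))

-- The testing process

cell : Act → ℕ → Proc
cell α o = sum α nil (nm o) nil

tester : ∀ n → (Fin n → Act) → (Fin n → ℕ) → Proc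
tester zero α o = nil
tester (suc n) α o = par (cell (α zero) (o zero)) (tester n (α ∘ suc) (o ∘ suc))

cell-event : ∀ {α o} → Bool → E ⟦ cell α o ⟧
cell-event true = inj₁ nothing
cell-event false = inj₂ nothing

-- The two events of the i-th cell: true is the action α i, false the barb o i.
event : ∀ {n} α o → Bool → Fin n → E ⟦ tester n α o ⟧
event α o b zero = left (cell-event {α zero} {o zero} b) , tt
event α o b (suc i) = right (event (α ∘ suc) (o ∘ suc) b i) , tt

-- A communication inside the tester uses every cell taking part in it, so one event may use several
-- cells.
Uses : ∀ {n} α o → E ⟦ tester n α o ⟧ → Fin n → Set
Uses α o (u , _) zero = Σ _ λ c → π₁ u ≡ just c
Uses α o (u , _) (suc i) = Σ _ λ q → π₂ u ≡ just q × Uses (α ∘ suc) (o ∘ suc) q i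

event-label : ∀ {n} α o b (i : Fin n) → ℓ ⟦ tester n α o ⟧ (event α o b i) ≡ act (if b then α i else nm (o i))
event-label α o true zero = refl
event-label α o false zero = refl
event-label α o b (suc i) = event-label (α ∘ suc) (o ∘ suc) b i

event-uses : ∀ {n} α o b (i : Fin n) → Uses α o (event α o b i) i
event-uses α o b zero = _ , refl
event-uses α o b (suc i) = _ , refl , event-uses (α ∘ suc) (o ∘ suc) b i

event-injective : ∀ {n} α o {b b'} {i j : Fin n} → event α o b i ≡ event α o b' j → i ≡ j
event-injective α o {i = zero} {zero} eq = refl
event-injective α o {i = zero} {suc j} ()
event-injective α o {i = suc i} {zero} ()
event-injective α o {i = suc i} {suc j} eq = cong suc (event-injective (α ∘ suc) (o ∘ suc) (just-injective (cong (π₂ ∘ proj₁) eq)))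

cell-unique : ∀ {α o x} → Conf ⟦ cell α o ⟧ x → ∀ {c c'} → x c → x c' → c ≡ c'
cell-unique (inj₁ _) {inj₁ nothing} {inj₁ nothing} _ _ = refl
cell-unique (inj₁ (_ , lift n)) {inj₂ c} m _ = contradiction m (n c)
cell-unique (inj₁ (_ , lift n)) {inj₁ _} {inj₂ c} _ m = contradiction m (n c)
cell-unique (inj₂ _) {inj₂ nothing} {inj₂ nothing} _ _ = refl
cell-unique (inj₂ (_ , lift n)) {inj₁ c} m _ = contradiction m (n c)
cell-unique (inj₂ (_ , lift n)) {inj₂ _} {inj₁ c} _ m = contradiction m (n c)

-- A cell is a choice between two single actions, so at most one of its events occurs; injectivity
-- of the projections lifts this through the nested compositions.
uses-unique : ∀ {n} α o {x} → Conf ⟦ tester n α o ⟧ x → ∀ {q q' i} → x q → x q' → Uses α o q i → Uses α o q' i → q ≡ q'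
uses-unique {suc n} α o {x} (c₁ , c₂ , i₁ , i₂ , _) {u , k} {u' , k'} {zero} m m' (c , eq) (c' , eq')
  with refl ← cell-unique {α zero} {o zero} {image π₁ (under-K x)} c₁ {c} {c'} (u , (k , m) , eq) (u' , (k' , m') , eq')
  with refl ← i₁ u u' c (k , m) (k' , m') eq eq' =
  cong (u ,_) (Kept-prop {⟦ cell (α zero) (o zero) ⟧} {⟦ tester n _ _ ⟧} {u} k k')
uses-unique {suc n} α o {x} (c₁ , c₂ , i₁ , i₂ , _) {u , k} {u' , k'} {suc i} m m' (q , eq , us) (q' , eq' , us')
  with refl ← uses-unique (α ∘ suc) (o ∘ suc) {image π₂ (under-K x)} c₂ {q} {q'} (u , (k , m) , eq) (u' , (k' , m') , eq') us us'
  with refl ← i₂ u u' q (k , m) (k' , m') eq eq' =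
  cong (u ,_) (Kept-prop {⟦ cell (α zero) (o zero) ⟧} {⟦ tester n _ _ ⟧} {u} k k')

-- About internal events only two distinct used cells and the label are recorded: the cells rule
-- them out as moves of the tester alone, the label as partners in a synchronisation.
data Shape {n} (α : Fin n → Act) (o : Fin n → ℕ) : E ⟦ tester n α o ⟧ → Set where
  single   : ∀ b i → Shape α o (event α o b i)
  internal : ∀ {q} i j → i ≢ j → Uses α o q i → Uses α o q j → ℓ ⟦ tester n α o ⟧ q ≡ τ → Shape α o q

shape-uses : ∀ {n} {α : Fin n → Act} {o q} → Shape α o q → Σ (Fin n) (Uses α o q)
shape-uses {α = α} {o} (single b i) = i , event-uses α o b i
shape-uses (internal i _ _ u _ _) = i , u

shape : ∀ {n} α o (q : E ⟦ tester n α o ⟧) → Shape α o q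
shape {suc n} α o (left (inj₁ nothing) , tt) = single true zero
shape {suc n} α o (left (inj₂ nothing) , tt) = single false zero
shape {suc n} α o (right q , tt) with shape (α ∘ suc) (o ∘ suc) q
... | single b i = single b (suc i)
... | internal i j ne u v eq = internal (suc i) (suc j) (ne ∘ suc-injective) (_ , refl , u) (_ , refl , v) eq
shape {suc n} α o (both c q , k) with shape-uses (shape (α ∘ suc) (o ∘ suc) q)
... | j , u = internal zero (suc j) (λ ()) (_ , refl) (_ , refl , u) refl

-- `σ` gives the state of each cell: untouched, action `α i` performed (`true`), or barb fired
-- (`false`).
Chosen : ∀ {n} α o → (Fin n → Maybe Bool) → Subset (E ⟦ tester n α o ⟧)
Chosen {n} α o σ q = Σ (Fin n) λ i → Σ Bool λ b → σ i ≡ just b × q ≡ event α o b i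

cell-conf : ∀ {α o} (m : Maybe Bool) → Conf ⟦ cell α o ⟧ (λ c → Σ Bool λ b → m ≡ just b × c ≡ cell-event {α} {o} b)
cell-conf nothing = inj₁ (inj₁ (lift λ { _ (_ , () , _) }) , lift λ { _ (_ , () , _) })
cell-conf (just true) = inj₁ (inj₂ (lift (true , refl , refl) , lift λ ()) , lift λ { _ (true , _ , ()) ; _ (false , () , _) })
cell-conf (just false) = inj₂ (inj₂ (lift (false , refl , refl) , lift λ ()) , lift λ { _ (false , _ , ()) ; _ (true , () , _) })

chosen-conf : ∀ {n} α o (σ : Fin n → Maybe Bool) → Conf ⟦ tester n α o ⟧ (Chosen α o σ)
chosen-conf {zero} α o σ = lift λ ()
chosen-conf {suc n} α o σ = prod-ext eq (interleave-conf (cell-conf {α zero} {o zero} (σ zero)) (chosen-conf (α ∘ suc) (o ∘ suc) (σ ∘ suc)))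
  where
  open Product ⟦ cell (α zero) (o zero) ⟧ ⟦ tester n (α ∘ suc) (o ∘ suc) ⟧ (proc-stable (cell (α zero) (o zero))) (proc-stable (tester n (α ∘ suc) (o ∘ suc)))
  eq : interleave (λ c → Σ Bool λ b → σ zero ≡ just b × c ≡ cell-event {α zero} {o zero} b) (Chosen (α ∘ suc) (o ∘ suc) (σ ∘ suc))
       ≐ under-K (Chosen α o σ)
  eq (left c) = (λ { (b , p , refl) → tt , zero , b , p , refl }) , (λ { (tt , zero , b , p , refl) → b , p , refl ; (tt , suc i , b , p , ()) })
  eq (right q) = (λ { (i , b , p , refl) → tt , suc i , b , p , refl }) , (λ { (tt , suc i , b , p , refl) → i , b , p , refl ; (tt , zero , b , p , ()) })
  eq (both _ _) = (λ ()) , (λ { (_ , zero , _ , _ , ()) ; (_ , suc _ , _ , _ , ()) })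

module TesterConf {n} (α : Fin n → Act) (o : Fin n → ℕ) {x : Subset (E ⟦ tester n α o ⟧)}
                  (x? : ∀ q → Dec (x q)) (syncs : ∀ q → x q → Σ (Fin n) λ i → q ≡ event α o true i) where
  private
    open module ST = Stable (proc-stable (tester n α o)) using ()

    mark : {A : Set} → Dec A → Maybe Bool
    mark (yes _) = just true
    mark (no _) = nothing

    mark-just : {A : Set} (d : Dec A) {b : Bool} → mark d ≡ just b → A × b ≡ true
    mark-just (yes a) refl = a , refl

    mark-yes : {A : Set} (d : Dec A) → A → mark d ≡ just true
    mark-yes (yes _) a = refl
    mark-yes (no n) a = contradiction a n

  -- Cells are independent, so every decidable set of synchronising events is a configuration. The
  -- tester therefore never obstructs the undoing of a synchronisation.
  syncs-conf : Conf ⟦ tester n α o ⟧ x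
  syncs-conf = ST.ext eq (chosen-conf α o (λ i → mark (x? (event α o true i))))
    where
    eq : Chosen α o (λ i → mark (x? (event α o true i))) ≐ x
    proj₁ (eq q) (i , b , p , refl) with m , refl ← mark-just (x? _) p = m
    proj₂ (eq q) m with i , refl ← syncs q m = i , true , mark-yes (x? _) m , refl

  add-conf : ∀ b i → ¬ x (event α o true i) → Conf ⟦ tester n α o ⟧ (x ▷ event α o b i)
  add-conf b i new = ST.ext eq (chosen-conf α o σ)
    where
    σ : Fin n → Maybe Bool
    σ j with j ≟ᶠ i
    ... | yes _ = just b
    ... | no _ = mark (x? (event α o true j))
    eq : Chosen α o σ ≐ x ▷ event α o b i
    proj₁ (eq q) (j , b' , p , refl) with j ≟ᶠ i
    proj₁ (eq q) (j , b' , refl , refl) | yes refl = inj₂ refl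
    ... | no _ with m , refl ← mark-just (x? _) p = inj₁ m
    proj₂ (eq q) (inj₂ refl) = i , b , here-σ , refl
      where
      here-σ : σ i ≡ just b
      here-σ with i ≟ᶠ i
      ... | yes _ = refl
      ... | no ne = contradiction refl ne
    proj₂ (eq q) (inj₁ m) with j , refl ← syncs q m = j , true , there-σ , refl
      where
      there-σ : σ j ≡ just true
      there-σ with j ≟ᶠ i
      ... | yes refl = contradiction m new
      ... | no _ = mark-yes (x? _) m

-- Barbed congruence is hereditary history preserving

step-target : ∀ {C x e y y'} → Step C x e y → Step C x e y' → y ≐ y'
step-target (_ , _ , _ , s) (_ , _ , _ , s') a = proj₂ (s' a) ∘ proj₁ (s a) , proj₂ (s a) ∘ proj₁ (s' a)

step-source : ∀ {C x x' e y} → Step C x e y → Step C x' e y → x ≐ x'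
step-source {C} {x} {x'} {e} {y} st st' a = half st st' , half st' st
  where
  half : ∀ {u v} → Step C u e y → Step C v e y → u a → v a
  half (_ , _ , n , s) (_ , _ , _ , s') m with proj₁ (s' a) (proj₂ (s a) (inj₁ m))
  ... | inj₁ m' = m'
  ... | inj₂ refl = contradiction m n

image-▷-just : {A B : Set} {π : A → Maybe B} {x : Subset A} {a : A} {b : B} → π a ≡ just b →
  image π (x ▷ a) ≐ image π x ▷ b
image-▷-just eq c =
    ⊎-map id (λ eq' → just-injective (trans (sym eq') eq)) ∘ proj₁ (image-▷ c)
  , proj₂ (image-▷ c) ∘ ⊎-map id (λ { refl → eq })

image-▷-nothing : {A B : Set} {π : A → Maybe B} {x : Subset A} {a : A} → π a ≡ nothing →
  image π (x ▷ a) ≐ image π x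
image-▷-nothing eq c =
    [ id , (λ eq' → contradiction (trans (sym eq) eq') λ ()) ]′ ∘ proj₁ (image-▷ c)
  , proj₂ (image-▷ c) ∘ inj₁

image-remove-just : {A B : Set} {π : A → Maybe B} {x : Subset A} {a : A} {b : B} → InjOn π x → x a → π a ≡ just b →
  image π (x - a) ≐ image π x - b
image-remove-just {a = a} inj xa eq c =
    (λ { (w , (m , ne) , e) → (w , m , e) , λ { refl → ne (inj w a c m xa e eq) } })
  , (λ { ((w , m , e) , ne) → w , (m , λ { refl → ne (just-injective (trans (sym e) eq)) }) , e })

image-remove-nothing : {A B : Set} {π : A → Maybe B} {x : Subset A} {a : A} → π a ≡ nothing →
  image π (x - a) ≐ image π x
image-remove-nothing eq c =
    (λ { (w , (m , _) , e) → w , m , e })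
  , (λ { (w , m , e) → w , (m , λ { refl → contradiction (trans (sym eq) e) λ () }) , e })

act-injective : ∀ {a b} → act a ≡ act b → a ≡ b
act-injective refl = refl

nm-injective : ∀ {a b} → nm a ≡ nm b → a ≡ b
nm-injective refl = refl

both-injective : {A B : Set} {a a' : A} {b b' : B} → both a b ≡ both a' b' → a ≡ a' × b ≡ b'
both-injective refl = refl , refl

Compl-functional : ∀ {l m m'} → Compl l m → Compl l m' → m ≡ m'
Compl-functional (nm-co b) (nm-co .b) = refl
Compl-functional (co-nm b) (co-nm .b) = refl

-- Chains of τ events and their alignment

data Chain (C : CS) (x : Subset (E C)) : List (E C) → Set₁ where
  []   : Chain C x []
  link : ∀ {t ts} → ¬ t ∈ ts → (∀ t' → t' ∈ ts → Le C x t' t) → Chain C x ts → Chain C x (t ∷ ts)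

chain-shrink : ∀ {C x y ts} → x ⊆ y → Chain C y ts → Chain C x ts
chain-shrink p [] = []
chain-shrink p (link n le ch) = link n (λ t' m z cz z⊆ → le t' m z cz (λ a → p a ∘ z⊆ a)) (chain-shrink p ch)

-- Causality among events of `x` persists in a larger configuration: by stability, a
-- subconfiguration of `y` can be cut down to `x`.
chain-grow : ∀ {C} → StableCS C → ∀ {x y ts} → Conf C x → Conf C y → x ⊆ y → (∀ t → t ∈ ts → x t) →
  Chain C x ts → Chain C y ts
chain-grow S cx cy p ts⊆x [] = []
chain-grow S cx cy p ts⊆x (link n le ch) =
  link n (λ t' m z cz z⊆ zt → proj₁ (le t' m _ (Stable.∩-conf S cy cz cx z⊆ p) (λ _ → proj₂) (zt , ts⊆x _ (here refl))))
       (chain-grow S cx cy p (λ t → ts⊆x t ∘ there) ch)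

data Aligned {A B : Set} : List A → List B → A → B → Set where
  here  : ∀ {a as b bs} → Aligned (a ∷ as) (b ∷ bs) a b
  there : ∀ {a as b bs c d} → Aligned as bs a b → Aligned (c ∷ as) (d ∷ bs) a b

aligned-sym : {A B : Set} {as : List A} {bs : List B} → ∀ {a b} → Aligned as bs a b → Aligned bs as b a
aligned-sym here = here
aligned-sym (there m) = there (aligned-sym m)

aligned-∈ : {A B : Set} {as : List A} {bs : List B} → ∀ {a b} → Aligned as bs a b → a ∈ as
aligned-∈ here = here refl
aligned-∈ (there m) = there (aligned-∈ m)

aligned-total : {A B : Set} {as : List A} {bs : List B} → length as ≡ length bs → ∀ {a} → a ∈ as → Σ B λ b → Aligned as bs a b
aligned-total {bs = []} () (here _)
aligned-total {bs = []} () (there _)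
aligned-total {bs = b ∷ bs} eq (here refl) = b , here
aligned-total {bs = b ∷ bs} eq (there m) = let c , p = aligned-total (ℕ.suc-injective eq) m in c , there p

aligned-functional : ∀ {C x as} {B : Set} {bs : List B} → Chain C x as → ∀ {a b b'} → Aligned as bs a b → Aligned as bs a b' → b ≡ b'
aligned-functional _ here here = refl
aligned-functional (link n _ _) here (there m) = contradiction (aligned-∈ m) n
aligned-functional (link n _ _) (there m) here = contradiction (aligned-∈ m) n
aligned-functional (link _ _ ch) (there m) (there m') = aligned-functional ch m m'

-- One process in parallel with the tester

module Testing {n} (α : Fin n → Act) (o : Fin n → ℕ)
               (o-injective : ∀ {i j} → o i ≡ o j → i ≡ j) (α-fresh : ∀ i j → α i ≢ nm (o j)) where
  Q : CS
  Q = ⟦ tester n α o ⟧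

  private
    SQ : StableCS Q
    SQ = proc-stable (tester n α o)
    open module SQ = Stable SQ using ()

  sync barb : Fin n → E Q
  sync = event α o true
  barb = event α o false

  sync≢barb : ∀ {i j} → sync i ≢ barb j
  sync≢barb {i} {j} eq = α-fresh i j (act-injective
    (trans (sym (event-label α o true i)) (trans (cong (ℓ Q) eq) (event-label α o false j))))

  sync-visible : ∀ {i} → ℓ Q (sync i) ≢ τ
  sync-visible {i} eq = contradiction (trans (sym (event-label α o true i)) eq) λ ()

  barb-visible : ∀ {i} → ℓ Q (barb i) ≢ τ
  barb-visible {i} eq = contradiction (trans (sym (event-label α o false i)) eq) λ ()

  barb-uses : ∀ q i → ℓ Q q ≡ act (nm (o i)) → Uses α o q i
  barb-uses q i eq with shape α o q
  ... | single true j = contradiction (act-injective (trans (sym (event-label α o true j)) eq)) (α-fresh j i)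
  ... | single false j with refl ← o-injective (nm-injective (act-injective (trans (sym (event-label α o false j)) eq))) = event-uses α o false j
  ... | internal _ _ _ _ _ eq' = contradiction (trans (sym eq') eq) λ ()

  record Side (C : CS) : Set₁ where
    field
      stable   : StableCS C
      singly   : SinglyLabelledCS C
      fresh-nm : ∀ i e → ℓ C e ≢ act (nm (o i))
      fresh-co : ∀ i e → ℓ C e ≢ act (co (o i))
      pick     : E C → Fin n
      pick-injective : ∀ {e e'} → pick e ≡ pick e' → e ≡ e'
      pick-compl     : ∀ e → ℓ C e ≢ τ → Compl (act (α (pick e))) (ℓ C e)

  module OneSide {C : CS} (s : Side C) where
    open Side s
    open Parallel Q C SQ stable public
    private
      open module S = Stable stable using ()

    -- The shape of the configurations reached in the game: visible events of the process occur only
    -- together with a cell, and the tester does nothing by itself.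
    Synced : Subset (E Par) → Set
    Synced X = ∀ u → under-K X u →
      (Σ (Fin n) λ i → Σ (E C) λ e → u ≡ both (sync i) e) ⊎ (Σ (E C) λ t → u ≡ right t × ℓ C t ≡ τ)

    synced-p₁ : ∀ {X} → Synced X → ∀ q → p₁ X q → Σ (Fin n) λ i → q ≡ sync i
    synced-p₁ ok q (u , m , eq) with ok u m
    synced-p₁ ok q (u , m , refl) | inj₁ (i , e , refl) = i , refl
    synced-p₁ ok q (u , m , ()) | inj₂ (t , refl , _)

    enables : ∀ {X i} → Conf Par X → Synced X → ¬ p₁ X (sync i) → Σ _ λ X' → Step Par X (left (barb i) , tt) X'
    enables {X} {i} c ok new = _ , add-step tt c
      (λ { q refl m → let j , eq = synced-p₁ ok q m in sync≢barb (sym eq) }) (λ _ ())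
      (SQ.ext (≐-sym (image-▷-just refl)) (TesterConf.add-conf α o (SQ.dec (proj₁ c)) (synced-p₁ ok) false i new))
      (S.ext (≐-sym (image-▷-nothing refl)) (proj₁ (proj₂ c)))

    -- A step labelled `o i` is made by the tester alone, since the name is foreign to `C` and
    -- communications are τ; its event uses cell `i`, which has room for one event only.
    disables : ∀ {X q i} → p₁ X q → Uses α o q i → ∀ {e X'} → Step Par X e X' → ℓ Par e ≢ act (nm (o i))
    disables {X} {q} {i} m us {left q' , k} {X'} st eq =
      step-fresh₁ {X} {X'} {left q'} {k} st q' refl (subst (p₁ X)
        (uses-unique α o (proj₁ (proj₁ (proj₂ st))) (proj₂ (step-p₁ st q) (inj₁ m)) (proj₂ (step-p₁ st q') (inj₂ refl))
          us (barb-uses q' i eq)) m)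
    disables {i = i} m us {right e , _} st eq = fresh-nm i e eq
    disables m us {both _ _ , _} st ()

    -- `ts` lists the τ events, latest first. `own` guarantees that an enabled visible event finds
    -- its cell free: only the event itself could have consumed it.
    record SideState (X : Subset (E Par)) (ts : List (E C)) : Set₁ where
      field
        conf   : Conf Par X
        synced : Synced X
        taus   : ∀ t → Iff (under-K X (right t)) (t ∈ ts)
        chain  : Chain C (p₂ X) ts
        own    : ∀ e e' → under-K X (both (sync (pick e)) e') → e' ≡ e

    tau-label : ∀ {X t} → Synced X → under-K X (right t) → ℓ C t ≡ τ
    tau-label ok m with ok _ m
    ... | inj₂ (_ , refl , eq) = eq

    taus-in-p₂ : ∀ {X ts} → SideState X ts → ∀ t → t ∈ ts → p₂ X t
    taus-in-p₂ σ t m = right t , proj₂ (SideState.taus σ t) m , refl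

    p₂-grows : ∀ {X e X'} → Step Par X e X' → p₂ X ⊆ p₂ X'
    p₂-grows st b = proj₂ (step-p₂ st b) ∘ inj₁

    initial : SideState ∅ []
    initial = record { conf = Stable.∅-conf (par-stable Q C SQ stable) ; synced = λ _ () ; taus = λ _ → (λ ()) , λ ()
                     ; chain = [] ; own = λ _ _ () }

    -- The hypothesis on `i` serves both roles: a challenger consumes its own cell, an answer a cell
    -- picked by no event on its side.
    grow-sync : ∀ {X ts i e k X'} → SideState X ts → Step Par X (both (sync i) e , k) X' →
      (∀ e' → pick e' ≡ i → e ≡ e') → SideState X' ts
    grow-sync {X} {ts} {i} {e} {k} {X'} σ st pk = record
      { conf = proj₁ (proj₂ st) ; synced = synced' ; taus = taus'
      ; chain = chain-grow stable (proj₁ (proj₂ conf)) (proj₁ (proj₂ (proj₁ (proj₂ st)))) (p₂-grows st) (taus-in-p₂ σ) chain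
      ; own = own' }
      where
      open SideState σ
      synced' : Synced X'
      synced' u m with proj₁ (step-add st u) m
      ... | inj₁ m' = synced u m'
      ... | inj₂ refl = inj₁ (i , e , refl)
      taus' : ∀ t → Iff (under-K X' (right t)) (t ∈ ts)
      taus' t = [ proj₁ (taus t) , (λ ()) ]′ ∘ proj₁ (step-add st (right t)) , step-old st (right t) ∘ proj₂ (taus t)
      own' : ∀ a b → under-K X' (both (sync (pick a)) b) → b ≡ a
      own' a b m with proj₁ (step-add st _) m
      ... | inj₁ m' = own a b m'
      ... | inj₂ eq with eq₁ , refl ← both-injective eq = pk a (event-injective α o eq₁)

    -- Here single labelling is applied: the new event shares the label τ with all of `ts`, so it
    -- lies above each of them and may head the chain.
    grow-tau : ∀ {X ts t k X'} → SideState X ts → Step Par X (right t , k) X' → ℓ C t ≡ τ → SideState X' (t ∷ ts)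
    grow-tau {X} {ts} {t} {k} {X'} σ st lab = record
      { conf = proj₁ (proj₂ st) ; synced = synced' ; taus = taus'
      ; chain = link (step-fresh st ∘ proj₂ (taus t))
          (λ t' m → Removal.same-label-below C stable singly (step-right st refl) (taus-in-p₂ σ t' m)
             (trans (tau-label synced (proj₂ (taus t') m)) (sym lab)))
          (chain-grow stable (proj₁ (proj₂ conf)) (proj₁ (proj₂ (proj₁ (proj₂ st)))) (p₂-grows st) (taus-in-p₂ σ) chain)
      ; own = λ a b m → [ own a b , (λ ()) ]′ (proj₁ (step-add st _) m) }
      where
      open SideState σ
      synced' : Synced X'
      synced' u m with proj₁ (step-add st u) m
      ... | inj₁ m' = synced u m'
      ... | inj₂ refl = inj₂ (t , refl , lab)
      taus' : ∀ t' → Iff (under-K X' (right t')) (t' ∈ t ∷ ts)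
      proj₁ (taus' t') m with proj₁ (step-add st (right t')) m
      ... | inj₁ m' = there (proj₁ (taus t') m')
      ... | inj₂ refl = here refl
      proj₂ (taus' t') (here refl) = step-new st
      proj₂ (taus' t') (there m) = step-old st _ (proj₂ (taus t') m)

    shrink-sync : ∀ {X ts q e k X'} → SideState X ts → Step Par X' (both q e , k) X → SideState X' ts
    shrink-sync {X} {ts} {X' = X'} σ st = record
      { conf = proj₁ st ; synced = λ u → synced u ∘ step-old st u
      ; taus = λ t → proj₁ (taus t) ∘ step-old st (right t) , [ id , (λ ()) ]′ ∘ proj₁ (step-add st (right t)) ∘ proj₂ (taus t)
      ; chain = chain-shrink (p₂-grows st) chain
      ; own = λ a b → own a b ∘ step-old st _ }
      where
      open SideState σ

    -- Every τ event is below the head of the list, so only the head can be undone.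
    shrink-tau : ∀ {X ts t k X'} → SideState X ts → Step Par X' (right t , k) X →
      Σ (List (E C)) λ ts' → ts ≡ t ∷ ts' × SideState X' ts'
    shrink-tau {ts = []} {t} σ st with () ← proj₁ (SideState.taus σ t) (step-new st)
    shrink-tau {X} {t₀ ∷ ts'} {t} {k} {X'} σ st with SideState.chain σ | t S.≟ t₀
    ... | link n le ch | yes refl = ts' , refl , record
      { conf = proj₁ st ; synced = λ u → synced u ∘ step-old st u
      ; taus = λ t' → to t' , from t'
      ; chain = chain-shrink (p₂-grows st) ch
      ; own = λ a b → own a b ∘ step-old st _ }
      where
      open SideState σ
      to : ∀ t' → under-K X' (right t') → t' ∈ ts'
      to t' m with proj₁ (taus t') (step-old st _ m)
      ... | here refl = contradiction m (step-fresh st)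
      ... | there m' = m'
      from : ∀ t' → t' ∈ ts' → under-K X' (right t')
      from t' m with proj₁ (step-add st _) (proj₂ (taus t') (there m))
      ... | inj₁ m' = m'
      ... | inj₂ refl = contradiction m n
    ... | link n le ch | no t≢t₀ with proj₁ (SideState.taus σ t) (step-new st)
    ... | here eq = contradiction eq t≢t₀
    -- Otherwise `p₂ X'` would be a configuration with the head `t₀` but without `t`, which lies
    -- below `t₀`.
    ... | there m = contradiction
      (le t m (p₂ X') (proj₁ (proj₂ (proj₁ st))) (p₂-grows st) (right t₀ , head-stays , refl))
      (step-fresh₂ st t refl)
      where
      head-stays : under-K X' (right t₀)
      head-stays with proj₁ (step-add st _) (proj₂ (SideState.taus σ t₀) (here refl))
      ... | inj₁ m' = m'
      ... | inj₂ refl = contradiction refl t≢t₀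

    can-tau : ∀ {X ts e x'} → SideState X ts → Step C (p₂ X) e x' → Step Par X (right e , tt) (X ▷ (right e , tt))
    can-tau σ st@(_ , _ , n , _) = add-step tt (SideState.conf σ) (λ _ ()) (λ { _ refl → n })
      (SQ.ext (≐-sym (image-▷-nothing refl)) (proj₁ (SideState.conf σ)))
      (S.ext (≐-trans (proj₂ (proj₂ (proj₂ st))) (≐-sym (image-▷-just refl))) (proj₁ (proj₂ st)))

    can-sync : ∀ {X ts e x'} → SideState X ts → Step C (p₂ X) e x' → ℓ C e ≢ τ →
      Σ _ λ k → Step Par X (both (sync (pick e)) e , k) (X ▷ (both (sync (pick e)) e , k))
    can-sync {X} {e = e} σ st@(_ , _ , n , _) vis = _ , add-step
      (subst (λ l → Compl l (ℓ C e)) (sym (event-label α o true (pick e))) (pick-compl e vis))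
      conf (λ { _ refl → unused }) (λ { _ refl → n })
      (SQ.ext (≐-sym (image-▷-just refl)) (TesterConf.add-conf α o (SQ.dec (proj₁ conf)) (synced-p₁ synced) true (pick e) unused))
      (S.ext (≐-trans (proj₂ (proj₂ (proj₂ st))) (≐-sym (image-▷-just refl))) (proj₁ (proj₂ st)))
      where
      open SideState σ
      -- A consumed cell would, by `own`, have been consumed by `e`, which has not occurred yet.
      unused : ¬ p₁ X (sync (pick e))
      unused (u , m , eq) with synced u m
      ... | inj₂ (_ , refl , _) = contradiction eq λ ()
      ... | inj₁ (i , e' , refl) = n (subst (p₂ X) (own e e' (subst (λ q → under-K X (both q e')) (just-injective eq) m)) (_ , m , refl))

    -- Whatever the process can undo, the composition can undo: in a synced configuration the
    -- tester's share of the event is nothing or a synchronising event, removable in any order.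
    undo : ∀ {X ts x' e} → SideState X ts → Step C x' e (p₂ X) →
      (Σ (Fin n) λ i → Σ _ λ k → Σ _ λ X' → Step Par X' (both (sync i) e , k) X)
      ⊎ (ℓ C e ≡ τ × Σ _ λ X' → Step Par X' (right e , tt) X)
    undo {X} {x' = x'} {e} σ st@(cx' , _ , n , s) with proj₂ (s e) (inj₂ refl)
    ... | u , m , eq with SideState.synced σ u m
    undo {X} {x' = x'} σ st@(cx' , _ , n , s) | u , (k , m) , refl | inj₂ (e , refl , lab) = inj₂ (lab , _ , del-step conf m
      (SQ.ext (≐-sym (image-remove-nothing refl)) (proj₁ conf)) (S.ext (≐-trans x'≐ (≐-sym (image-remove-just i₂ (k , m) refl))) cx'))
      where
      open SideState σ
      i₂ : InjOn π₂ (under-K X)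
      i₂ = proj₁ (proj₂ (proj₂ (proj₂ conf)))
      x'≐ : x' ≐ p₂ X - e
      x'≐ a = (λ m → proj₂ (s a) (inj₁ m) , λ { refl → n m }) , λ { (m , ne) → [ id , (λ eq → contradiction eq ne) ]′ (proj₁ (s a) m) }
    undo {X} {x' = x'} σ st@(cx' , _ , n , s) | u , (k , m) , refl | inj₁ (i , e , refl) = inj₁ (i , k , _ , del-step conf m
      (SQ.ext (≐-sym (image-remove-just i₁ (k , m) refl))
        (TesterConf.syncs-conf α o (λ q → SQ.dec (proj₁ conf) q ×-dec ¬? (q SQ.≟ sync i)) (λ q → synced-p₁ synced q ∘ proj₁)))
      (S.ext (≐-trans x'≐ (≐-sym (image-remove-just i₂ (k , m) refl))) cx'))
      where
      open SideState σ
      i₁ : InjOn π₁ (under-K X)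
      i₁ = proj₁ (proj₂ (proj₂ conf))
      i₂ : InjOn π₂ (under-K X)
      i₂ = proj₁ (proj₂ (proj₂ (proj₂ conf)))
      x'≐ : x' ≐ p₂ X - e
      x'≐ a = (λ m → proj₂ (s a) (inj₁ m) , λ { refl → n m }) , λ { (m , ne) → [ id , (λ eq → contradiction eq ne) ]′ (proj₁ (s a) m) }

  -- Answering the challenges of one side

  module Half {C₁ C₂ : CS} (s₁ : Side C₁) (s₂ : Side C₂)
              (disjoint : ∀ e e' → Side.pick s₁ e ≢ Side.pick s₂ e')
              (B : BRel (parCS Q C₁) (parCS Q C₂))
              (clauses₁ : BClauses (parCS Q C₁) (parCS Q C₂) B)
              (clauses₂ : BClauses (parCS Q C₂) (parCS Q C₁) (λ X₂ X₁ → B X₁ X₂)) where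
    private
      open module O₁ = OneSide s₁ using ()
      open module O₂ = OneSide s₂ using ()

    -- Were cell `i` untouched in `X₁`, its barb would be enabled there but not in `X₂`. The event
    -- `q` is arbitrary because an answer is not known in advance to be a synchronisation, and `X₂`
    -- need not be synced.
    agree₁ : ∀ {X₁ X₂ q i} → B X₁ X₂ → Conf O₁.Par X₁ → O₁.Synced X₁ → O₂.p₁ X₂ q → Uses α o q i → O₁.p₁ X₁ (sync i)
    agree₁ {X₁} {X₂} {q} {i} rel c₁ ok m us with SQ.dec (proj₁ c₁) (sync i)
    ... | yes m₁ = m₁
    ... | no new =
      let X₁' , st = O₁.enables c₁ ok new
          e₂ , X₂' , st₂ , eq = proj₂ (proj₂ (clauses₁ X₁ X₂ rel)) _ X₁' st barb-visible
      in ⊥-elim (O₂.disables m us st₂ (trans eq (event-label α o false i)))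

    agree₂ : ∀ {X₁ X₂ q i} → B X₁ X₂ → Conf O₂.Par X₂ → O₂.Synced X₂ → O₁.p₁ X₁ q → Uses α o q i → O₂.p₁ X₂ (sync i)
    agree₂ {X₁} {X₂} {q} {i} rel c₂ ok m us with SQ.dec (proj₁ c₂) (sync i)
    ... | yes m₂ = m₂
    ... | no new =
      let X₂' , st = O₂.enables c₂ ok new
          e₁ , X₁' , st₁ , eq = proj₂ (proj₂ (clauses₂ X₂ X₁ rel)) _ X₂' st barb-visible
      in ⊥-elim (O₁.disables m us st₁ (trans eq (event-label α o false i)))

    record State (X₁ : Subset (E O₁.Par)) (X₂ : Subset (E O₂.Par)) (ts₁ : List (E C₁)) (ts₂ : List (E C₂)) : Set₁ where
      constructor mkState
      field
        rel    : B X₁ X₂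
        len    : length ts₁ ≡ length ts₂
        state₁ : O₁.SideState X₁ ts₁
        state₂ : O₂.SideState X₂ ts₂

    -- Events are paired through the cell they synchronised with, τ events through their
    -- position in the order of execution.
    Paired : Subset (E O₁.Par) → Subset (E O₂.Par) → List (E C₁) → List (E C₂) → E C₁ → E C₂ → Set
    Paired X₁ X₂ ts₁ ts₂ a b =
      (Σ (Fin n) λ i → under-K X₁ (both (sync i) a) × under-K X₂ (both (sync i) b)) ⊎ Aligned ts₁ ts₂ a b

    module _ {X₁ X₂ ts₁ ts₂} (σ : State X₁ X₂ ts₁ ts₂) where
      open State σ
      private
        open module σ₁ = O₁.SideState state₁ using ()
        open module σ₂ = O₂.SideState state₂ using ()

      paired-dom : ∀ a b → Paired X₁ X₂ ts₁ ts₂ a b → O₁.p₂ X₁ a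
      paired-dom a b (inj₁ (i , m , _)) = _ , m , refl
      paired-dom a b (inj₂ al) = O₁.taus-in-p₂ state₁ a (aligned-∈ al)

      paired-total : ∀ a → O₁.p₂ X₁ a → Σ (E C₂) λ b → Paired X₁ X₂ ts₁ ts₂ a b
      paired-total a (u , m , eq) with σ₁.synced u m
      paired-total a (u , m , refl) | inj₂ (t , refl , _) =
        let b , al = aligned-total len (proj₁ (σ₁.taus t) m) in b , inj₂ al
      paired-total a (u , m , refl) | inj₁ (i , e , refl)
        with agree₂ rel σ₂.conf σ₂.synced (_ , m , refl) (event-uses α o true i)
      ... | v , m' , eq' with σ₂.synced v m'
      ... | inj₂ (_ , refl , _) = contradiction eq' λ ()
      ... | inj₁ (j , b , refl) = b , inj₁ (i , m , subst (λ q → under-K X₂ (both q b)) (just-injective eq') m')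

      -- `a` occurs in one composite event of `X₁` only, which decides between τ and synchronisation
      -- and fixes the cell; the cell occurs in one composite event of `X₂` only, which fixes the
      -- partner.
      paired-functional : ∀ a b b' → Paired X₁ X₂ ts₁ ts₂ a b → Paired X₁ X₂ ts₁ ts₂ a b' → b ≡ b'
      paired-functional a b b' (inj₂ p) (inj₂ p') = aligned-functional σ₁.chain p p'
      paired-functional a b b' (inj₂ p) (inj₁ (i , m , _)) =
        contradiction (proj₁ (proj₂ (proj₂ (proj₂ σ₁.conf))) _ _ a (proj₂ (σ₁.taus a) (aligned-∈ p)) m refl refl) λ ()
      paired-functional a b b' (inj₁ (i , m , _)) (inj₂ p) =
        contradiction (proj₁ (proj₂ (proj₂ (proj₂ σ₁.conf))) _ _ a (proj₂ (σ₁.taus a) (aligned-∈ p)) m refl refl) λ ()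
      paired-functional a b b' (inj₁ (i , m , n)) (inj₁ (j , m' , n')) =
        proj₂ (both-injective (proj₁ (proj₂ (proj₂ σ₂.conf)) _ _ (sync i) n n' refl (cong just (sym i≡j))))
        where
        i≡j : sync i ≡ sync j
        i≡j = proj₁ (both-injective (proj₁ (proj₂ (proj₂ (proj₂ σ₁.conf))) _ _ a m m' refl refl))

      -- Synchronised partners are complementary to the same cell action, and complements are
      -- unique.
      paired-label : ∀ a b → Paired X₁ X₂ ts₁ ts₂ a b → ℓ C₂ b ≡ ℓ C₁ a
      paired-label a b (inj₁ (i , (k , _) , (k' , _))) = Compl-functional k' k
      paired-label a b (inj₂ al) = trans
        (O₂.tau-label σ₂.synced (proj₂ (σ₂.taus b) (aligned-∈ (aligned-sym al))))
        (sym (O₁.tau-label σ₁.synced (proj₂ (σ₁.taus a) (aligned-∈ al))))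

      -- A cell used by the answer must also be used by the challenge, for otherwise its barb
      -- would be observable on one side only.
      new-use : ∀ {X₁' u k X₂' q j} → B X₁' X₂' → Conf O₁.Par X₁' → O₁.Synced X₁' → Step O₂.Par X₂ (u , k) X₂' →
        π₁ u ≡ just q → Uses α o q j → O₁.p₁ X₁' (sync j) × ¬ O₁.p₁ X₁ (sync j)
      new-use {X₂' = X₂'} {q} {j} rel' c₁' ok₁' st eq us =
        agree₁ rel' c₁' ok₁' q∈ us , λ m →
          let m₂ = agree₂ rel σ₂.conf σ₂.synced m (event-uses α o true j)
          in O₂.step-fresh₁ st q eq (subst (O₂.p₁ X₂)
               (uses-unique α o (proj₁ (proj₁ (proj₂ st))) (proj₂ (O₂.step-p₁ st (sync j)) (inj₁ m₂)) q∈ (event-uses α o true j) us) m₂)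
        where
        q∈ : O₂.p₁ X₂' q
        q∈ = proj₂ (O₂.step-p₁ st q) (inj₂ eq)

    -- Read from the smaller to the larger configurations, so that the same lemmas serve doing and
    -- undoing.
    Extended : Subset (E O₁.Par) → Subset (E O₂.Par) → List (E C₁) → List (E C₂) →
               Subset (E O₁.Par) → Subset (E O₂.Par) → List (E C₁) → List (E C₂) → E C₁ → E C₂ → Set
    Extended X₁ X₂ ts₁ ts₂ X₁' X₂' ts₁' ts₂' e₁ e₂ =
      ∀ a b → Iff (Paired X₁' X₂' ts₁' ts₂' a b) (Paired X₁ X₂ ts₁ ts₂ a b ⊎ (a ≡ e₁ × b ≡ e₂))

    extended-sync : ∀ {X₁ X₂ ts₁ ts₂ X₁' X₂' i e₁ e₂ k₁ k₂} → Step O₁.Par X₁ (both (sync i) e₁ , k₁) X₁' →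
      Step O₂.Par X₂ (both (sync i) e₂ , k₂) X₂' → Extended X₁ X₂ ts₁ ts₂ X₁' X₂' ts₁ ts₂ e₁ e₂
    proj₁ (extended-sync st₁ st₂ a b) (inj₂ al) = inj₁ (inj₂ al)
    proj₁ (extended-sync st₁ st₂ a b) (inj₁ (j , m₁ , m₂)) with proj₁ (O₁.step-add st₁ _) m₁ | proj₁ (O₂.step-add st₂ _) m₂
    ... | inj₁ m₁' | inj₁ m₂' = inj₁ (inj₁ (j , m₁' , m₂'))
    ... | inj₂ eq₁ | inj₂ eq₂ = inj₂ (proj₂ (both-injective eq₁) , proj₂ (both-injective eq₂))
    -- In the mixed cases `j` is the cell just consumed, although one side would have consumed it
    -- before.
    ... | inj₁ m₁' | inj₂ eq₂ = contradiction (_ , m₁' , cong just (proj₁ (both-injective eq₂))) (O₁.step-fresh₁ st₁ _ refl)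
    ... | inj₂ eq₁ | inj₁ m₂' = contradiction (_ , m₂' , cong just (proj₁ (both-injective eq₁))) (O₂.step-fresh₁ st₂ _ refl)
    proj₂ (extended-sync st₁ st₂ a b) (inj₁ (inj₂ al)) = inj₂ al
    proj₂ (extended-sync st₁ st₂ a b) (inj₁ (inj₁ (j , m₁ , m₂))) = inj₁ (j , O₁.step-old st₁ _ m₁ , O₂.step-old st₂ _ m₂)
    proj₂ (extended-sync {i = i} st₁ st₂ a b) (inj₂ (refl , refl)) = inj₁ (i , O₁.step-new st₁ , O₂.step-new st₂)

    extended-tau : ∀ {X₁ X₂ ts₁ ts₂ X₁' X₂' e₁ e₂ k₁ k₂} → Step O₁.Par X₁ (right e₁ , k₁) X₁' →
      Step O₂.Par X₂ (right e₂ , k₂) X₂' → Extended X₁ X₂ ts₁ ts₂ X₁' X₂' (e₁ ∷ ts₁) (e₂ ∷ ts₂) e₁ e₂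
    proj₁ (extended-tau st₁ st₂ a b) (inj₂ here) = inj₂ (refl , refl)
    proj₁ (extended-tau st₁ st₂ a b) (inj₂ (there al)) = inj₁ (inj₂ al)
    proj₁ (extended-tau st₁ st₂ a b) (inj₁ (j , m₁ , m₂)) with proj₁ (O₁.step-add st₁ _) m₁ | proj₁ (O₂.step-add st₂ _) m₂
    ... | inj₁ m₁' | inj₁ m₂' = inj₁ (inj₁ (j , m₁' , m₂'))
    proj₂ (extended-tau st₁ st₂ a b) (inj₁ (inj₂ al)) = inj₂ (there al)
    proj₂ (extended-tau st₁ st₂ a b) (inj₁ (inj₁ (j , m₁ , m₂))) = inj₁ (j , O₁.step-old st₁ _ m₁ , O₂.step-old st₂ _ m₂)
    proj₂ (extended-tau st₁ st₂ a b) (inj₂ (refl , refl)) = inj₂ here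

    Answer : Subset (E O₁.Par) → Subset (E O₂.Par) → List (E C₁) → List (E C₂) → E C₁ → Subset (E C₁) → Set₁
    Answer X₁ X₂ ts₁ ts₂ e₁ x₁' = Σ (E C₂) λ e₂ → Σ _ λ X₁' → Σ _ λ X₂' → Σ _ λ ts₁' → Σ _ λ ts₂' →
      State X₁' X₂' ts₁' ts₂' × x₁' ≐ O₁.p₂ X₁' × Step C₂ (O₂.p₂ X₂) e₂ (O₂.p₂ X₂')
      × Extended X₁ X₂ ts₁ ts₂ X₁' X₂' ts₁' ts₂' e₁ e₂

    forth : ∀ {X₁ X₂ ts₁ ts₂ e₁ x₁'} → State X₁ X₂ ts₁ ts₂ → Step C₁ (O₁.p₂ X₁) e₁ x₁' → Answer X₁ X₂ ts₁ ts₂ e₁ x₁'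
    forth {X₁} {X₂} {ts₁} {ts₂} {e₁} {x₁'} σ st with ℓ C₁ e₁ in lab
    ... | τ = answer u₂ k₂ st₂ lab₂ rel'
      where
      open State σ
      st₁ : Step O₁.Par X₁ (right e₁ , tt) (X₁ ▷ (right e₁ , tt))
      st₁ = O₁.can-tau state₁ st
      state₁' : O₁.SideState (X₁ ▷ (right e₁ , tt)) (e₁ ∷ ts₁)
      state₁' = O₁.grow-tau state₁ st₁ lab
      b : Σ (E O₂.Par) λ e₂ → Σ (Subset (E O₂.Par)) λ X₂' → Step O₂.Par X₂ e₂ X₂' × ℓ O₂.Par e₂ ≡ τ × B (X₁ ▷ (right e₁ , tt)) X₂'
      b = proj₁ (proj₂ (clauses₁ X₁ X₂ rel)) _ _ st₁ lab
      u₂ = proj₁ (proj₁ b)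
      k₂ = proj₂ (proj₁ b)
      st₂ = proj₁ (proj₂ (proj₂ b))
      lab₂ = proj₁ (proj₂ (proj₂ (proj₂ b)))
      rel' = proj₂ (proj₂ (proj₂ (proj₂ b)))
      -- The challenge consumes no cell, so neither may the answer; this leaves a move of `C₂`
      -- alone.
      no-cell : ∀ {u k X₂' q} → Step O₂.Par X₂ (u , k) X₂' → B (X₁ ▷ (right e₁ , tt)) X₂' → ¬ π₁ u ≡ just q
      no-cell {q = q} st₂ rel' eq with shape-uses (shape α o q)
      ... | j , us with new-use σ rel' (O₁.SideState.conf state₁') (O₁.SideState.synced state₁') st₂ eq us
      ... | m , n with proj₁ (O₁.step-p₁ st₁ (sync j)) m
      ... | inj₁ m' = n m'
      answer : ∀ u k {X₂'} → Step O₂.Par X₂ (u , k) X₂' → ℓ O₂.Par (u , k) ≡ τ → B (X₁ ▷ (right e₁ , tt)) X₂' →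
        Answer X₁ X₂ ts₁ ts₂ e₁ x₁'
      answer (left q) k st₂ lab₂ rel' = contradiction refl (no-cell st₂ rel')
      answer (both q _) k st₂ lab₂ rel' = contradiction refl (no-cell st₂ rel')
      answer (right e₂) k st₂ lab₂ rel' = e₂ , _ , _ , _ , _ ,
        mkState rel' (cong suc len) state₁' (O₂.grow-tau state₂ st₂ lab₂) ,
        step-target {C₁} st (O₁.step-right st₁ refl) , O₂.step-right st₂ refl , extended-tau st₁ st₂
    ... | act β = answer u₂ k₂ st₂ lab₂ rel'
      where
      open State σ
      i : Fin n
      i = Side.pick s₁ e₁
      vis : ℓ C₁ e₁ ≢ τ
      vis eq = contradiction (trans (sym lab) eq) λ ()
      k₁ : Kept Q C₁ (both (sync i) e₁)
      k₁ = proj₁ (O₁.can-sync state₁ st vis)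
      X₁' : Subset (E O₁.Par)
      X₁' = X₁ ▷ (both (sync i) e₁ , k₁)
      st₁ : Step O₁.Par X₁ (both (sync i) e₁ , k₁) X₁'
      st₁ = proj₂ (O₁.can-sync state₁ st vis)
      state₁' : O₁.SideState X₁' ts₁
      state₁' = O₁.grow-sync state₁ st₁ (λ e' eq → sym (Side.pick-injective s₁ eq))
      b : Σ (E O₂.Par) λ e₂ → Σ (Subset (E O₂.Par)) λ X₂' → Step O₂.Par X₂ e₂ X₂' × ℓ O₂.Par e₂ ≡ τ × B X₁' X₂'
      b = proj₁ (proj₂ (clauses₁ X₁ X₂ rel)) _ _ st₁ refl
      u₂ = proj₁ (proj₁ b)
      k₂ = proj₂ (proj₁ b)
      st₂ = proj₁ (proj₂ (proj₂ b))
      lab₂ = proj₁ (proj₂ (proj₂ (proj₂ b)))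
      rel' = proj₂ (proj₂ (proj₂ (proj₂ b)))
      only-i : ∀ {u k X₂' q j} → Step O₂.Par X₂ (u , k) X₂' → B X₁' X₂' → π₁ u ≡ just q → Uses α o q j → j ≡ i
      only-i {j = j} st₂ rel' eq us with new-use σ rel' (O₁.SideState.conf state₁') (O₁.SideState.synced state₁') st₂ eq us
      ... | m , n with proj₁ (O₁.step-p₁ st₁ (sync j)) m
      ... | inj₁ m' = contradiction m' n
      ... | inj₂ eq' = sym (event-injective α o (just-injective eq'))
      answer : ∀ u k {X₂'} → Step O₂.Par X₂ (u , k) X₂' → ℓ O₂.Par (u , k) ≡ τ → B X₁' X₂' →
        Answer X₁ X₂ ts₁ ts₂ e₁ x₁'
      answer (left q) k st₂ lab₂ rel' with shape α o q
      ... | single true j = contradiction lab₂ sync-visible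
      ... | single false j = contradiction lab₂ barb-visible
      -- Two distinct cells would both have to be the challenged cell `i`.
      ... | internal j j' ne us us' _ = contradiction (trans (only-i st₂ rel' refl us) (sym (only-i st₂ rel' refl us'))) ne
      -- Without moving the tester, cell `i` can be consumed after the answer only if it was
      -- consumed before it, hence also in `X₁` before the challenge.
      answer (right e₂) k st₂ lab₂ rel' =
        contradiction (agree₁ rel (O₁.SideState.conf state₁) (O₁.SideState.synced state₁) i∈₂ (event-uses α o true i))
                      (O₁.step-fresh₁ st₁ _ refl)
        where
        state₂' = O₂.grow-tau state₂ st₂ lab₂
        i∈₂ : O₂.p₁ X₂ (sync i)
        i∈₂ with proj₁ (O₂.step-p₁ st₂ (sync i)) (agree₂ rel' (O₂.SideState.conf state₂') (O₂.SideState.synced state₂')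
                   (_ , O₁.step-new st₁ , refl) (event-uses α o true i))
        ... | inj₁ m = m
      answer (both q e₂) k st₂ lab₂ rel' with shape α o q
      ... | internal _ _ _ _ _ eq = contradiction (subst (λ l → Compl l (ℓ C₂ e₂)) eq k) λ ()
      ... | single false j = contradiction (co-label (subst (λ l → Compl l (ℓ C₂ e₂)) (event-label α o false j) k)) (Side.fresh-co s₂ j e₂)
        where
        co-label : ∀ {a l} → Compl (act (nm a)) l → l ≡ act (co a)
        co-label (nm-co _) = refl
      -- Cell `i` is allotted to an event of the first process, so no event of the second picks it
      -- and `own` survives there.
      ... | single true j with refl ← only-i st₂ rel' refl (event-uses α o true j) = e₂ , _ , _ , _ , _ ,
        mkState rel' len state₁' (O₂.grow-sync state₂ st₂ (λ e' eq → contradiction (sym eq) (disjoint e₁ e'))) ,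
        step-target {C₁} st (O₁.step-right st₁ refl) , O₂.step-right st₂ refl , extended-sync st₁ st₂

    Undone : Subset (E O₁.Par) → Subset (E O₂.Par) → List (E C₁) → List (E C₂) → E C₁ → Subset (E C₁) → Set₁
    Undone X₁ X₂ ts₁ ts₂ e₁ x₁' = Σ (E C₂) λ e₂ → Σ _ λ X₁' → Σ _ λ X₂' → Σ _ λ ts₁' → Σ _ λ ts₂' →
      State X₁' X₂' ts₁' ts₂' × x₁' ≐ O₁.p₂ X₁' × Step C₂ (O₂.p₂ X₂') e₂ (O₂.p₂ X₂)
      × Extended X₁' X₂' ts₁' ts₂' X₁ X₂ ts₁ ts₂ e₁ e₂

    back : ∀ {X₁ X₂ ts₁ ts₂ e₁ x₁'} → State X₁ X₂ ts₁ ts₂ → Step C₁ x₁' e₁ (O₁.p₂ X₁) → Undone X₁ X₂ ts₁ ts₂ e₁ x₁'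
    back {X₁} {X₂} {ts₁} {ts₂} {e₁} {x₁'} σ st with O₁.undo (State.state₁ σ) st
    ... | inj₁ (i , k₁ , X₁' , st₁) = answer _ _ (proj₁ (proj₂ (proj₂ b))) (proj₂ (proj₂ (proj₂ (proj₂ b))))
      where
      open State σ
      b : Σ (E O₂.Par) λ e₂ → Σ (Subset (E O₂.Par)) λ X₂' → Step O₂.Par X₂' e₂ X₂ × ℓ O₂.Par e₂ ≡ τ × B X₁' X₂'
      b = proj₁ (clauses₁ X₁ X₂ rel) _ _ st₁ refl
      state₁' : O₁.SideState X₁' ts₁
      state₁' = O₁.shrink-sync state₁ st₁
      answer : ∀ u k {X₂'} → Step O₂.Par X₂' (u , k) X₂ → B X₁' X₂' → Undone X₁ X₂ ts₁ ts₂ e₁ x₁'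
      -- Cell `i` is consumed in `X₂` by agreement with `X₁`, and free in `X₂'` by agreement with
      -- `X₁'`; so the undone event is the one that consumed it.
      answer u k {X₂'} st₂ rel' with proj₁ (O₂.step-p₁ st₂ (sync i))
            (agree₂ rel (O₂.SideState.conf state₂) (O₂.SideState.synced state₂) (_ , O₁.step-new st₁ , refl) (event-uses α o true i))
      ... | inj₁ m = contradiction
            (agree₁ rel' (O₁.SideState.conf state₁') (O₁.SideState.synced state₁') m (event-uses α o true i)) (O₁.step-fresh₁ st₁ _ refl)
      ... | inj₂ eq with O₂.SideState.synced state₂ u (O₂.step-new st₂)
      ...   | inj₂ (_ , refl , _) = contradiction eq λ ()
      ...   | inj₁ (j , e₂ , refl) with refl ← event-injective α o {i = j} {j = i} (just-injective eq) = e₂ , _ , _ , _ , _ ,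
        mkState rel' len state₁' (O₂.shrink-sync state₂ st₂) ,
        step-source {C₁} st (O₁.step-right st₁ refl) , O₂.step-right st₂ refl , extended-sync st₁ st₂
    ... | inj₂ (lab , X₁' , st₁) = answer _ _ (proj₁ (proj₂ (proj₂ b))) (proj₂ (proj₂ (proj₂ (proj₂ b))))
      where
      open State σ
      b : Σ (E O₂.Par) λ e₂ → Σ (Subset (E O₂.Par)) λ X₂' → Step O₂.Par X₂' e₂ X₂ × ℓ O₂.Par e₂ ≡ τ × B X₁' X₂'
      b = proj₁ (clauses₁ X₁ X₂ rel) _ _ st₁ lab
      answer : ∀ u k {X₂'} → Step O₂.Par X₂' (u , k) X₂ → B X₁' X₂' → Undone X₁ X₂ ts₁ ts₂ e₁ x₁'
      answer u k {X₂'} st₂ rel' with O₂.SideState.synced state₂ u (O₂.step-new st₂)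
      -- Undoing a synchronisation would free a cell on the second side only.
      ... | inj₁ (i , e₂ , refl) = contradiction i∈₂ (O₂.step-fresh₁ st₂ _ refl)
        where
        conf₂' = proj₁ st₂
        synced₂' : O₂.Synced X₂'
        synced₂' = O₂.SideState.synced (O₂.shrink-sync state₂ st₂)
        i∈₁ : O₁.p₁ X₁' (sync i)
        i∈₁ with proj₁ (O₁.step-p₁ st₁ (sync i)) (agree₁ rel (O₁.SideState.conf state₁) (O₁.SideState.synced state₁)
                   (_ , O₂.step-new st₂ , refl) (event-uses α o true i))
        ... | inj₁ m = m
        i∈₂ : O₂.p₁ X₂' (sync i)
        i∈₂ = agree₂ rel' conf₂' synced₂' i∈₁ (event-uses α o true i)
      -- Each side can undo only the head of its list, so both lists lose their heads and stay
      -- aligned.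
      ... | inj₂ (e₂ , refl , lab₂) with O₁.shrink-tau state₁ st₁ | O₂.shrink-tau state₂ st₂
      ... | ts₁' , refl , state₁' | ts₂' , refl , state₂' = e₂ , _ , _ , _ , _ ,
        mkState rel' (ℕ.suc-injective len) state₁' state₂' ,
        step-source {C₁} st (O₁.step-right st₁ refl) , O₂.step-right st₂ refl , extended-tau st₁ st₂

    -- `f` is compared with `Paired` only pointwise, because the back clause prescribes the
    -- restricted relation literally.
    Traced : HHRel C₁ C₂
    Traced x₁ x₂ f = Σ _ λ X₁ → Σ _ λ X₂ → Σ _ λ ts₁ → Σ _ λ ts₂ → State X₁ X₂ ts₁ ts₂
      × x₁ ≐ O₁.p₂ X₁ × x₂ ≐ O₂.p₂ X₂ × (∀ a b → Iff (f a b) (Paired X₁ X₂ ts₁ ts₂ a b))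

    traced-forth : Forth C₁ C₂ Traced
    traced-forth x₁ x₂ f (X₁ , X₂ , ts₁ , ts₂ , σ , x₁≐ , x₂≐ , f≐) e₁ x₁' st =
      let e₂ , X₁' , X₂' , ts₁' , ts₂' , σ' , x₁'≐ , st₂ , ex = forth σ (step-cong C₁ (Side.stable s₁) x₁≐ (λ _ → id , id) st)
      in e₂ , O₂.p₂ X₂' , Paired X₁' X₂' ts₁' ts₂' , step-cong C₂ (Side.stable s₂) (≐-sym x₂≐) (λ _ → id , id) st₂ ,
         (λ a b x₁a → (λ p → [ proj₂ (f≐ a b) , (λ { (refl , _) → contradiction x₁a (proj₁ (proj₂ (proj₂ st))) }) ]′ (proj₁ (ex a b) p))
                    , (λ p → proj₂ (ex a b) (inj₁ (proj₁ (f≐ a b) p)))) ,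
         X₁' , X₂' , ts₁' , ts₂' , σ' , x₁'≐ , (λ _ → id , id) , λ _ _ → id , id

    traced-back : Back C₁ C₂ Traced
    traced-back x₁ x₂ f (X₁ , X₂ , ts₁ , ts₂ , σ , x₁≐ , x₂≐ , f≐) e₁ x₁' st =
      let e₂ , X₁' , X₂' , ts₁' , ts₂' , σ' , x₁'≐ , st₂ , ex = back σ (step-cong C₁ (Side.stable s₁) (λ _ → id , id) x₁≐ st)
      in e₂ , O₂.p₂ X₂' , step-cong C₂ (Side.stable s₂) (λ _ → id , id) (≐-sym x₂≐) st₂ ,
         X₁' , X₂' , ts₁' , ts₂' , σ' , x₁'≐ , (λ _ → id , id) ,
         λ a b → (λ { (p , x₁'a) → [ id , (λ { (refl , _) → contradiction x₁'a (proj₁ (proj₂ (proj₂ st))) }) ]′ (proj₁ (ex a b) (proj₁ (f≐ a b) p)) })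
               , (λ p → proj₂ (f≐ a b) (proj₂ (ex a b) (inj₁ p)) , proj₂ (x₁'≐ a) (paired-dom σ' a b p))

    traced-half-bij : ∀ {x₁ x₂ f} → Traced x₁ x₂ f →
      (∀ a b → f a b → x₁ a) × (∀ a → x₁ a → Σ (E C₂) λ b → f a b)
      × (∀ a b b' → f a b → f a b' → b ≡ b') × (∀ a b → f a b → ℓ C₂ b ≡ ℓ C₁ a)
    traced-half-bij (X₁ , X₂ , ts₁ , ts₂ , σ , x₁≐ , x₂≐ , f≐) =
        (λ a b p → proj₂ (x₁≐ a) (paired-dom σ a b (proj₁ (f≐ a b) p)))
      , (λ a m → let b , p = paired-total σ a (proj₁ (x₁≐ a) m) in b , proj₂ (f≐ a b) p)
      , (λ a b b' p p' → paired-functional σ a b b' (proj₁ (f≐ a b) p) (proj₁ (f≐ a b') p'))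
      , (λ a b p → paired-label σ a b (proj₁ (f≐ a b) p))

  -- Combining the two sides

  module Both {C₁ C₂ : CS} (s₁ : Side C₁) (s₂ : Side C₂)
              (disjoint : ∀ e e' → Side.pick s₁ e ≢ Side.pick s₂ e')
              (B : BRel (parCS Q C₁) (parCS Q C₂)) (barbed : IsBarbed (parCS Q C₁) (parCS Q C₂) B) where
    private
      module H = Half s₁ s₂ disjoint B (proj₁ (proj₂ barbed)) (proj₂ (proj₂ barbed))
      module H⁻¹ = Half s₂ s₁ (λ e e' eq → disjoint e' e (sym eq)) (λ X₂ X₁ → B X₁ X₂) (proj₂ (proj₂ barbed)) (proj₁ (proj₂ barbed))
      module O₁ = OneSide s₁
      module O₂ = OneSide s₂

      flip-paired : ∀ X₁ X₂ {ts₁ ts₂ a b} → H.Paired X₁ X₂ ts₁ ts₂ a b → H⁻¹.Paired X₂ X₁ ts₂ ts₁ b a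
      flip-paired _ _ (inj₁ (i , m , m')) = inj₁ (i , m' , m)
      flip-paired _ _ (inj₂ al) = inj₂ (aligned-sym al)

      unflip-paired : ∀ X₁ X₂ {ts₁ ts₂ a b} → H⁻¹.Paired X₂ X₁ ts₂ ts₁ b a → H.Paired X₁ X₂ ts₁ ts₂ a b
      unflip-paired _ _ (inj₁ (i , m , m')) = inj₁ (i , m' , m)
      unflip-paired _ _ (inj₂ al) = inj₂ (aligned-sym al)

      flip : ∀ {x₁ x₂} {f : E C₁ → E C₂ → Set} → H.Traced x₁ x₂ f → H⁻¹.Traced x₂ x₁ (λ b a → f a b)
      flip (X₁ , X₂ , ts₁ , ts₂ , H.mkState r l σ₁ σ₂ , p₁ , p₂ , f≐) =
        X₂ , X₁ , ts₂ , ts₁ , H⁻¹.mkState r (sym l) σ₂ σ₁ , p₂ , p₁ ,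
        λ b a → flip-paired X₁ X₂ ∘ proj₁ (f≐ a b) , proj₂ (f≐ a b) ∘ unflip-paired X₁ X₂

      unflip : ∀ {x₁ x₂} {g : E C₂ → E C₁ → Set} → H⁻¹.Traced x₂ x₁ g → H.Traced x₁ x₂ (λ a b → g b a)
      unflip (X₂ , X₁ , ts₂ , ts₁ , H⁻¹.mkState r l σ₂ σ₁ , p₂ , p₁ , g≐) =
        X₁ , X₂ , ts₁ , ts₂ , H.mkState r (sym l) σ₁ σ₂ , p₁ , p₂ ,
        λ a b → unflip-paired X₁ X₂ ∘ proj₁ (g≐ b a) , proj₂ (g≐ b a) ∘ flip-paired X₁ X₂

      forth⁻¹ : Forth C₂ C₁ (converseHH {C₁} {C₂} H.Traced)
      forth⁻¹ x₂ x₁ g r e₂ x₂' st =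
        let e₁ , x₁' , g' , st₁ , ex , r' = H⁻¹.traced-forth x₂ x₁ g (flip r) e₂ x₂' st
        in e₁ , x₁' , g' , st₁ , ex , unflip r'

      back⁻¹ : Back C₂ C₁ (converseHH {C₁} {C₂} H.Traced)
      back⁻¹ x₂ x₁ g r e₂ x₂' st =
        let e₁ , x₁' , st₁ , r' = H⁻¹.traced-back x₂ x₁ g (flip r) e₂ x₂' st
        in e₁ , x₁' , st₁ , unflip r'

      confs : ∀ x₁ x₂ f → H.Traced x₁ x₂ f → Conf C₁ x₁ × Conf C₂ x₂
      confs _ _ _ (_ , _ , _ , _ , H.mkState _ _ σ₁ σ₂ , p₁ , p₂ , _) =
        Stable.ext (Side.stable s₁) (≐-sym p₁) (proj₁ (proj₂ (O₁.SideState.conf σ₁))) ,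
        Stable.ext (Side.stable s₂) (≐-sym p₂) (proj₁ (proj₂ (O₂.SideState.conf σ₂)))

      bij : ∀ x₁ x₂ f → H.Traced x₁ x₂ f → LabBij C₁ C₂ x₁ x₂ f
      bij _ _ _ r =
        let d₁ , t₁ , fn , lab = H.traced-half-bij r
            d₂ , t₂ , inj , _ = H⁻¹.traced-half-bij (flip r)
        in (λ a b p → d₁ a b p , d₂ b a p) , t₁ , t₂ , fn , (λ a a' b → inj b a a') , lab

    hhpb : C₁ ∼hh C₂
    hhpb = H.Traced , hereditary⇒HHPB C₁ C₂ (Side.stable s₁) (Side.stable s₂) H.Traced
      (∅ , ∅ , [] , [] , H.mkState (proj₁ barbed) refl O₁.initial O₂.initial ,
        (λ _ → (λ ()) , λ ()) , (λ _ → (λ ()) , λ ()) , λ a b → (λ ()) , λ { (inj₁ ()) ; (inj₂ ()) })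
      confs bij H.traced-forth forth⁻¹ H.traced-back back⁻¹

-- Choice of the cells and of the fresh names

name : Label → ℕ
name (act (nm a)) = a
name (act (co a)) = a
name τ = 0

-- The value at τ is junk; it must only differ from nm (o i).
complement : Label → Act
complement (act (nm a)) = co a
complement (act (co a)) = nm a
complement τ = co 0

complement-compl : ∀ l → l ≢ τ → Compl (act (complement l)) l
complement-compl (act (nm a)) _ = co-nm a
complement-compl (act (co a)) _ = nm-co a
complement-compl τ ne = contradiction refl ne

complement-nm : ∀ l {a} → complement l ≡ nm a → l ≡ act (co a)
complement-nm (act (co _)) refl = refl

barbed-congruence⇒hh : ∀ P₁ P₂ → SinglyLabelled P₁ → SinglyLabelled P₂ → P₁ ∼τ P₂ → ⟦ P₁ ⟧ ∼hh ⟦ P₂ ⟧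
barbed-congruence⇒hh P₁ P₂ singly₁ singly₂ cong-τ = Both.hhpb side₁ side₂
  (λ e e' eq → contradiction (index-injective (setoid _) (complete (inj₁ e)) (complete (inj₂ e')) eq) λ ())
  (proj₁ (cong-τ (parCtx (tester _ α o)))) (proj₂ (cong-τ (parCtx (tester _ α o))))
  where
  -- The coproduct serves as the disjoint union of the labelled events; positions in its enumeration
  -- are the cells, disjoint for the two processes.
  sum-CS : CS
  sum-CS = coprodCS ⟦ P₁ ⟧ ⟦ P₂ ⟧
  open Stable (coprod-stable ⟦ P₁ ⟧ ⟦ P₂ ⟧ (proc-stable P₁) (proc-stable P₂)) using (enum; complete)

  α : Fin (length enum) → Act
  α i = complement (ℓ sum-CS (lookup enum i))

  -- The successor makes this exceed every name in a label of either process; adding the position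
  -- keeps the barbs distinct.
  bound : ℕ
  bound = suc (max 0 (map (name ∘ ℓ sum-CS) enum))

  o : Fin (length enum) → ℕ
  o i = bound + toℕ i

  o-injective : ∀ {i j} → o i ≡ o j → i ≡ j
  o-injective eq = toℕ-injective (ℕ.+-cancelˡ-≡ bound _ _ eq)

  fresh : ∀ i e → name (ℓ sum-CS e) ≢ o i
  fresh i e eq = ℕ.<⇒≢ (ℕ.<-≤-trans
    (s≤s (v≤max⁺ 0 _ (inj₂ (lose (∈-map⁺ (name ∘ ℓ sum-CS) (complete e)) ℕ.≤-refl))))
    (ℕ.m≤m+n bound (toℕ i))) eq

  α-fresh : ∀ i j → α i ≢ nm (o j)
  α-fresh i j eq = fresh j (lookup enum i) (cong name (complement-nm _ eq))

  pick : E sum-CS → Fin (length enum)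
  pick e = index (complete e)

  pick-compl : ∀ e → ℓ sum-CS e ≢ τ → Compl (act (α (pick e))) (ℓ sum-CS e)
  pick-compl e vis = subst (λ e' → Compl (act (complement (ℓ sum-CS e'))) (ℓ sum-CS e))
    (lookup-index (complete e)) (complement-compl (ℓ sum-CS e) vis)

  open Testing α o o-injective α-fresh

  side₁ : Side ⟦ P₁ ⟧
  side₁ = record
    { stable = proc-stable P₁ ; singly = singly₁
    ; fresh-nm = λ i e eq → fresh i (inj₁ e) (cong name eq) ; fresh-co = λ i e eq → fresh i (inj₁ e) (cong name eq)
    ; pick = pick ∘ inj₁
    ; pick-injective = λ {e} {e'} eq → inj₁-injective (index-injective (setoid _) (complete (inj₁ e)) (complete (inj₁ e')) eq)
    ; pick-compl = pick-compl ∘ inj₁ }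

  side₂ : Side ⟦ P₂ ⟧
  side₂ = record
    { stable = proc-stable P₂ ; singly = singly₂
    ; fresh-nm = λ i e eq → fresh i (inj₂ e) (cong name eq) ; fresh-co = λ i e eq → fresh i (inj₂ e) (cong name eq)
    ; pick = pick ∘ inj₂
    ; pick-injective = λ {e} {e'} eq → inj₂-injective (index-injective (setoid _) (complete (inj₂ e)) (complete (inj₂ e')) eq)
    ; pick-compl = pick-compl ∘ inj₂ }

mainTheorem1 : (P₁ P₂ : Proc) → SinglyLabelled P₁ → SinglyLabelled P₂ →
    ((⟦ P₁ ⟧ ∼hh ⟦ P₂ ⟧ → P₁ ∼τ P₂) × (P₁ ∼τ P₂ → ⟦ P₁ ⟧ ∼hh ⟦ P₂ ⟧))
mainTheorem1 P₁ P₂ singly₁ singly₂ = hh⇒barbed-congruence P₁ P₂ , barbed-congruence⇒hh P₁ P₂ singly₁ singly₂
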